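{- Let $\mathbb{K}$ be a commutative ring with unit, $\mathsf{S}$ a minors system, $R$ a commutative $\mathbb{K}$-algebra, and $\Phi:\mathbb{K}\mathsf{S}\to R$ a morphism of linear species. Assume that $\Phi:\mathbb{K}\mathsf{S}[\varnothing]\to R$ is a morphism of $\mathbb{K}$-algebras and that there are two norms $N_1,N_2:\mathbb{K}\mathsf{S}\to R$ such that $$\Phi(X)=N_1(X\backslash e^{c})\,\Phi(X/e)+N_2(X/e^{c})\,\Phi(X\backslash e)$$ for every finite set $E$, every $X\in\mathsf{S}[E]$ and every $e\in E$. Then there exists a morphism of $\mathbb{K}$-algebras $\overline{\Phi}:\mathbb{K}[U(\mathsf{S})\times\mathsf{S}[\varnothing]\times U(\mathsf{S})]\to R$ such that $\Phi=\overline{\Phi}\circ T^{\mathsf{S}}$, where $T^{\mathsf{S}}$ is the universal Tutte character of $\mathsf{S}$.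
   Context: A set species $\mathsf{S}$ is a functor from finite sets and bijections to sets; the linear species $\mathbb{K}\mathsf{S}$ sends $E$ to the free $\mathbb{K}$-module $\mathbb{K}\mathsf{S}[E]$ on $\mathsf{S}[E]$. For a $\mathbb{K}$-module $R$, a morphism of linear species $\mathbb{K}\mathsf{S}\to R$ (with $R$ regarded as a constant species) is a family of linear maps $\mathbb{K}\mathsf{S}[E]\to R$ invariant under bijections of ground sets. A minors system is a set species $\mathsf{S}$ with, for every finite set $E$ and $A\subseteq E$, maps $\mathsf{S}[E]\to\mathsf{S}[A]$, $X\mapsto X|A$ (restriction) and $\mathsf{S}[E]\to \mathsf{S}[E\setminus A]$, $X\mapsto X/A$ (contraction), and maps $\mathsf{S}[E]\times\mathsf{S}[\varnothing]\to\mathsf{S}[E]$, $(X,Y)\mapsto X\oplus Y$ (direct sum), such that: restriction, contraction and $\oplus$ are compatible with bijections of ground sets; for disjoint $A,B\subseteq E$ and $X\in\mathsf{S}[E]$: $(X|A\sqcup B)|A=X|A$, $(X/A)|B=(X|A\sqcup B)/A$, $(X/A)/B=X/(A\sqcup B)$; $X|E=X$ and $X/\varnothing=X$ for $X\in\mathsf{S}[E]$; $X\oplus(Y\oplus Z)=(X\oplus Y)\oplus Z$ for $X\in\mathsf{S}[E]$, $Y,Z\in\mathsf{S}[\varnothing]$; $X\oplus Y=Y\oplus X$ for $X,Y\in\mathsf{S}[\varnothing]$; there is $1_{\mathsf{S}}\in\mathsf{S}[\varnothing]$ with $X\oplus 1_{\mathsf{S}}=X$ for all $X\in \mathsf{S}[E]$;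 $(X\oplus Y)|A=(X|A)\oplus Y$ and $(X\oplus Y)/A=(X/A)\oplus Y$ for $X\in\mathsf{S}[E]$, $Y\in\mathsf{S}[\varnothing]$, $A\subseteq E$. In particular $\mathsf{S}[\varnothing]$ is a commutative monoid under $\oplus$, and $\mathbb{K}\mathsf{S}[\varnothing]$ is its monoid algebra. Notation: for $X\in\mathsf{S}[E]$ and $A\subseteq E$, $A^c=E\setminus A$ and $X\backslash A=X|A^c$ (deletion); $e$ stands for $\{e\}$. Thus $X\backslash e^c=X|e$. A norm for $\mathsf{S}$ with values in a commutative monoid $U$ is a family of maps $N:\mathsf{S}[E]\to U$, invariant under bijections, with $N(X)=N(X|A)N(X/A)$ for all $A\subseteq E$, $N(X\oplus Y)=N(X)$ for $Y\in\mathsf{S}[\varnothing]$, and $N(1_{\mathsf{S}})=1$. A norm $\mathbb{K}\mathsf{S}\to R$ is the linear extension of a norm with values in the multiplicative monoid $(R,\cdot)$. The Grothendieck monoid $U(\mathsf{S})$ is the commutative monoid generated by symbols $[X]$, for all isomorphism classes $X$ of structures, with relations $[X]=[X|A][X/A]$ ($A\subseteq E$), $[X\oplus Y]=[X]$ ($Y\in\mathsf{S}[\varnothing]$), $[1_{\mathsf{S}}]=1$. The universal Tutte character $T^{\mathsf{S}}:\mathbb{K}\mathsf{S}\to\mathbb{K}[U(\mathsf{S})\times\mathsf{S}[\varnothing]\times U(\mathsf{S})]$ (values in the monoid algebra) is given for $X\in\mathsf{S}[E]$ by $$T^{\mathsf{S}}(X)=\sum_{A\subseteq E}\big([X|A],\,(X|A)/A,\,[X/A]\big).$$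 -}

module Defs where

open import Algebra.Bundles using (CommutativeMonoid; CommutativeRing)
import Algebra.Construct.DirectProduct as DirectProduct
open import Algebra.Module.Bundles using (LeftModule)
import Algebra.Module.Core as Action
import Algebra.Module.Morphism.Structures as ModuleMorphism
open import Algebra.Module.Structures using (IsLeftModule)
import Algebra.Morphism.Structures as RingMorphism
open import Algebra.Structures using (IsCommutativeMonoid; IsCommutativeRing)
open import Data.Bool.Base using (Bool; true; false; not; _∨_; if_then_else_; T)
open import Data.Bool.Properties using (T-irrelevant)
open import Data.Empty using (⊥; ⊥-elim)
open import Data.Fin.Base using (Fin; zero; suc)
import Data.Fin.Properties as Fin
open import Data.Fin.Subset using (Subset; inside; outside)
open import Data.List.Base as List using (List; []; _∷_; [_]; _++_)
open import Data.List.Properties using (++-assoc; ++-identityʳ; map-++)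
open import Data.Nat.Base as ℕ using (ℕ; zero; suc)
open import Data.Product.Base using (Σ; _×_; _,_; proj₁; proj₂; map₁; map₂)
open import Data.Sum.Base using (_⊎_; inj₁; inj₂)
open import Data.Sum.Function.Propositional using (_⊎-↔_)
open import Data.Unit.Base using (tt)
open import Data.Vec.Base as Vec using (lookup)
open import Function.Base using (_∘_)
open import Function.Bundles using (_↔_; Inverse; mk↔ₛ′)
open import Function.Construct.Composition using (_↔-∘_)
open import Function.Construct.Identity using (↔-id)
open import Function.Construct.Symmetry using (↔-sym)
open import Level using (Level; _⊔_) renaming (zero to 0ℓ; suc to lsuc)
open import Relation.Binary.Bundles using (Setoid)
open import Relation.Binary.PropositionalEquality
  using (_≡_; _≗_; refl; sym; trans; cong; subst)
import Relation.Binary.Reasoning.Setoid as SetoidReasoning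
open import Relation.Nullary using (¬_; does)

record CommutativeAlgebra {k ℓk} (K : CommutativeRing k ℓk) (r ℓr : Level)
       : Set (k ⊔ ℓk ⊔ lsuc (r ⊔ ℓr)) where
  private module K = CommutativeRing K
  field
    commutativeRing : CommutativeRing r ℓr
  open CommutativeRing commutativeRing public
  infixr 7 _*ₗ_
  field
    _*ₗ_         : Action.Opₗ K.Carrier Carrier
    isLeftModule : IsLeftModule K.ring _≈_ _+_ 0# -_ _*ₗ_
    *ₗ-*-assoc   : ∀ a x y → (a *ₗ x) * y ≈ a *ₗ (x * y)

  leftModule : LeftModule K.ring r ℓr
  leftModule = record { isLeftModule = isLeftModule }

module _ {k ℓk a ℓa b ℓb} {K : CommutativeRing k ℓk}
         (A : CommutativeAlgebra K a ℓa) (B : CommutativeAlgebra K b ℓb) where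
  private
    module K = CommutativeRing K
    module A = CommutativeAlgebra A
    module B = CommutativeAlgebra B
  open RingMorphism.RingMorphisms A.rawRing B.rawRing using (IsRingHomomorphism)

  record IsAlgebraHomomorphism (f : A.Carrier → B.Carrier) : Set (k ⊔ a ⊔ ℓa ⊔ ℓb) where
    field
      isRingHomomorphism : IsRingHomomorphism f
      *ₗ-homo            : ∀ (c : K.Carrier) x → f (c A.*ₗ x) B.≈ c B.*ₗ f x

  record AlgebraHomomorphism : Set (k ⊔ a ⊔ ℓa ⊔ b ⊔ ℓb) where
    field
      ⟦_⟧                   : A.Carrier → B.Carrier
      isAlgebraHomomorphism : IsAlgebraHomomorphism ⟦_⟧

-- A list (a₁ , x₁) ∷ … ∷ (aₙ , xₙ) ∷ [] stands for a₁x₁ + … + aₙxₙ.  Equality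
-- of the basis X need not be decidable, so formal sums are compared by the
-- congruence generated by reordering, collecting like terms and dropping
-- zero terms rather than by their coefficients.
module FreeModule {k ℓk x ℓx} (K : CommutativeRing k ℓk) (X : Setoid x ℓx) where
  private
    module K = CommutativeRing K
    module X = Setoid X

  FormalSum : Set (k ⊔ x)
  FormalSum = List (K.Carrier × X.Carrier)

  infix 4 _≋_
  data _≋_ : FormalSum → FormalSum → Set (k ⊔ ℓk ⊔ x ⊔ ℓx) where
    ≋-refl  : ∀ {u} → u ≋ u
    ≋-sym   : ∀ {u v} → u ≋ v → v ≋ u
    ≋-trans : ∀ {u v w} → u ≋ v → v ≋ w → u ≋ w
    ∷-cong  : ∀ {a b y z u v} → a K.≈ b → y X.≈ z → u ≋ v → (a , y) ∷ u ≋ (b , z) ∷ v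
    swap    : ∀ s t {u} → s ∷ t ∷ u ≋ t ∷ s ∷ u
    collect : ∀ a b y {u} → (a , y) ∷ (b , y) ∷ u ≋ (a K.+ b , y) ∷ u
    drop    : ∀ y {u} → (K.0# , y) ∷ u ≋ u

  basis : X.Carrier → FormalSum
  basis y = [ K.1# , y ]

  scale : K.Carrier → FormalSum → FormalSum
  scale a = List.map (map₁ (a K.*_))

  negate : FormalSum → FormalSum
  negate = List.map (map₁ (λ a → K.- a))

  ≋-setoid : Setoid (k ⊔ x) (k ⊔ ℓk ⊔ x ⊔ ℓx)
  ≋-setoid = record
    { _≈_           = _≋_
    ; isEquivalence = record { refl = ≋-refl ; sym = ≋-sym ; trans = ≋-trans }
    }

  ≡⇒≋ : ∀ {u v} → u ≡ v → u ≋ v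
  ≡⇒≋ refl = ≋-refl

  ∷-congʳ : ∀ t {u v} → u ≋ v → t ∷ u ≋ t ∷ v
  ∷-congʳ t = ∷-cong K.refl X.refl

  ++-congʳ : ∀ u {v w} → v ≋ w → u ++ v ≋ u ++ w
  ++-congʳ []      p = p
  ++-congʳ (t ∷ u) p = ∷-congʳ t (++-congʳ u p)

  ++-congˡ : ∀ {u v} w → u ≋ v → u ++ w ≋ v ++ w
  ++-congˡ w ≋-refl          = ≋-refl
  ++-congˡ w (≋-sym p)       = ≋-sym (++-congˡ w p)
  ++-congˡ w (≋-trans p q)   = ≋-trans (++-congˡ w p) (++-congˡ w q)
  ++-congˡ w (∷-cong a≈b y≈z p) = ∷-cong a≈b y≈z (++-congˡ w p)
  ++-congˡ w (swap s t)      = swap s t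
  ++-congˡ w (collect a b y) = collect a b y
  ++-congˡ w (drop y)        = drop y

  ++-cong : ∀ {u u′ v v′} → u ≋ u′ → v ≋ v′ → u ++ v ≋ u′ ++ v′
  ++-cong {u′ = u′} {v = v} p q = ≋-trans (++-congˡ v p) (++-congʳ u′ q)

  ++-shift : ∀ t u v → t ∷ (u ++ v) ≋ u ++ t ∷ v
  ++-shift t []      v = ≋-refl
  ++-shift t (s ∷ u) v = ≋-trans (swap t s) (∷-congʳ s (++-shift t u v))

  ++-comm : ∀ u v → u ++ v ≋ v ++ u
  ++-comm []      v = ≡⇒≋ (sym (++-identityʳ v))
  ++-comm (t ∷ u) v = ≋-trans (∷-congʳ t (++-comm u v)) (++-shift t v u)

  ++-isCommutativeMonoid : IsCommutativeMonoid _≋_ _++_ []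
  ++-isCommutativeMonoid = record
    { isMonoid = record
      { isSemigroup = record
        { isMagma = record
          { isEquivalence = Setoid.isEquivalence ≋-setoid
          ; ∙-cong        = ++-cong
          }
        ; assoc = λ u v w → ≡⇒≋ (++-assoc u v w)
        }
      ; identity = (λ _ → ≋-refl) , (λ u → ≡⇒≋ (++-identityʳ u))
      }
    ; comm = ++-comm
    }

  ++-interchange : ∀ u v w z → (u ++ v) ++ (w ++ z) ≋ (u ++ w) ++ (v ++ z)
  ++-interchange u v w z = begin
    (u ++ v) ++ (w ++ z)  ≡⟨ ++-assoc u v (w ++ z) ⟩
    u ++ (v ++ (w ++ z))  ≡⟨ cong (u ++_) (++-assoc v w z) ⟨
    u ++ ((v ++ w) ++ z)  ≈⟨ ++-congʳ u (++-congˡ z (++-comm v w)) ⟩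
    u ++ ((w ++ v) ++ z)  ≡⟨ cong (u ++_) (++-assoc w v z) ⟩
    u ++ (w ++ (v ++ z))  ≡⟨ ++-assoc u w (v ++ z) ⟨
    (u ++ w) ++ (v ++ z)  ∎
    where open SetoidReasoning ≋-setoid

  drop≈ : ∀ {a} y {u} → a K.≈ K.0# → (a , y) ∷ u ≋ u
  drop≈ y p = ≋-trans (∷-cong p X.refl ≋-refl) (drop y)

  mapCoeff-cong : (h : K.Carrier → K.Carrier) →
                  (∀ {a b} → a K.≈ b → h a K.≈ h b) →
                  (∀ a b → h a K.+ h b K.≈ h (a K.+ b)) →
                  h K.0# K.≈ K.0# →
                  ∀ {u v} → u ≋ v → List.map (map₁ h) u ≋ List.map (map₁ h) v
  mapCoeff-cong h hc h+ h0 = go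
    where
    go : ∀ {u v} → u ≋ v → List.map (map₁ h) u ≋ List.map (map₁ h) v
    go ≋-refl          = ≋-refl
    go (≋-sym p)       = ≋-sym (go p)
    go (≋-trans p q)   = ≋-trans (go p) (go q)
    go (∷-cong a≈b y≈z p) = ∷-cong (hc a≈b) y≈z (go p)
    go (swap s t)      = swap _ _
    go (collect a b y) = ≋-trans (collect _ _ y) (∷-cong (h+ a b) X.refl ≋-refl)
    go (drop y)        = drop≈ y h0

  scale-cong : ∀ {a b u v} → a K.≈ b → u ≋ v → scale a u ≋ scale b v
  scale-cong {a} {b} {u} a≈b p =
    ≋-trans (coeff u)
            (mapCoeff-cong (b K.*_) K.*-congˡ (λ c d → K.sym (K.distribˡ b c d)) (K.zeroʳ b) p)
    where
    coeff : ∀ w → scale a w ≋ scale b w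
    coeff []            = ≋-refl
    coeff ((c , y) ∷ w) = ∷-cong (K.*-congʳ a≈b) X.refl (coeff w)

  scale-zeroˡ : ∀ u → scale K.0# u ≋ []
  scale-zeroˡ []            = ≋-refl
  scale-zeroˡ ((c , y) ∷ u) = ≋-trans (drop≈ y (K.zeroˡ c)) (scale-zeroˡ u)

  scale-distribʳ : ∀ u a b → scale (a K.+ b) u ≋ scale a u ++ scale b u
  scale-distribʳ []            a b = ≋-refl
  scale-distribʳ ((c , y) ∷ u) a b = begin
    ((a K.+ b) K.* c , y) ∷ scale (a K.+ b) u
      ≈⟨ ∷-cong (K.distribʳ c a b) X.refl (scale-distribʳ u a b) ⟩
    (a K.* c K.+ b K.* c , y) ∷ (scale a u ++ scale b u)
      ≈⟨ collect _ _ y ⟨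
    (a K.* c , y) ∷ (b K.* c , y) ∷ (scale a u ++ scale b u)
      ≈⟨ ∷-congʳ _ (++-shift _ (scale a u) (scale b u)) ⟩
    (a K.* c , y) ∷ (scale a u ++ (b K.* c , y) ∷ scale b u) ∎
    where open SetoidReasoning ≋-setoid

  scale-identity : ∀ u → scale K.1# u ≋ u
  scale-identity []            = ≋-refl
  scale-identity ((c , y) ∷ u) = ∷-cong (K.*-identityˡ c) X.refl (scale-identity u)

  scale-assoc : ∀ a b u → scale (a K.* b) u ≋ scale a (scale b u)
  scale-assoc a b []            = ≋-refl
  scale-assoc a b ((c , y) ∷ u) = ∷-cong (K.*-assoc a b c) X.refl (scale-assoc a b u)

  negate-cong : ∀ {u v} → u ≋ v → negate u ≋ negate v
  negate-cong = mapCoeff-cong (λ a → K.- a) K.-‿cong -‿+ -0≈0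
    where
    -0≈0 : K.- K.0# K.≈ K.0#
    -0≈0 = K.trans (K.sym (K.+-identityˡ _)) (K.-‿inverseʳ K.0#)

    -‿+ : ∀ a b → (K.- a) K.+ (K.- b) K.≈ K.- (a K.+ b)
    -‿+ a b = begin
      na K.+ nb                                     ≈⟨ K.+-identityʳ _ ⟨
      (na K.+ nb) K.+ K.0#                          ≈⟨ K.+-congˡ (K.-‿inverseʳ (a K.+ b)) ⟨
      (na K.+ nb) K.+ ((a K.+ b) K.+ nab)           ≈⟨ K.+-assoc _ _ _ ⟨
      ((na K.+ nb) K.+ (a K.+ b)) K.+ nab           ≈⟨ K.+-congʳ cancel ⟩
      K.0# K.+ nab                                  ≈⟨ K.+-identityˡ _ ⟩
      nab                                           ∎
      where
      open SetoidReasoning K.setoid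
      na = K.- a
      nb = K.- b
      nab = K.- (a K.+ b)
      cancel : (na K.+ nb) K.+ (a K.+ b) K.≈ K.0#
      cancel = begin
        (na K.+ nb) K.+ (a K.+ b)    ≈⟨ K.+-assoc _ _ _ ⟩
        na K.+ (nb K.+ (a K.+ b))    ≈⟨ K.+-congˡ (K.+-congˡ (K.+-comm a b)) ⟩
        na K.+ (nb K.+ (b K.+ a))    ≈⟨ K.+-congˡ (K.+-assoc _ _ _) ⟨
        na K.+ ((nb K.+ b) K.+ a)    ≈⟨ K.+-congˡ (K.+-congʳ (K.-‿inverseˡ b)) ⟩
        na K.+ (K.0# K.+ a)          ≈⟨ K.+-congˡ (K.+-identityˡ a) ⟩
        na K.+ a                     ≈⟨ K.-‿inverseˡ a ⟩
        K.0#                         ∎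

  negate-inverseˡ : ∀ u → negate u ++ u ≋ []
  negate-inverseˡ []            = ≋-refl
  negate-inverseˡ ((c , y) ∷ u) = begin
    (K.- c , y) ∷ (negate u ++ (c , y) ∷ u)    ≈⟨ ∷-congʳ _ (++-shift _ (negate u) u) ⟨
    (K.- c , y) ∷ (c , y) ∷ (negate u ++ u)    ≈⟨ collect _ _ y ⟩
    ((K.- c) K.+ c , y) ∷ (negate u ++ u)      ≈⟨ drop≈ y (K.-‿inverseˡ c) ⟩
    negate u ++ u                              ≈⟨ negate-inverseˡ u ⟩
    []                                         ∎
    where open SetoidReasoning ≋-setoid

  negate-inverseʳ : ∀ u → u ++ negate u ≋ []
  negate-inverseʳ u = ≋-trans (++-comm u (negate u)) (negate-inverseˡ u)

  isLeftModule : IsLeftModule K.ring _≋_ _++_ [] negate scale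
  isLeftModule = record
    { isLeftSemimodule = record
      { +ᴹ-isCommutativeMonoid = ++-isCommutativeMonoid
      ; isPreleftSemimodule = record
        { *ₗ-cong      = scale-cong
        ; *ₗ-zeroˡ     = scale-zeroˡ
        ; *ₗ-distribʳ  = scale-distribʳ
        ; *ₗ-identityˡ = scale-identity
        ; *ₗ-assoc     = scale-assoc
        ; *ₗ-zeroʳ     = λ _ → ≋-refl
        ; *ₗ-distribˡ  = λ a u v → ≡⇒≋ (map-++ (map₁ (a K.*_)) u v)
        }
      }
    ; -ᴹ‿cong    = negate-cong
    ; -ᴹ‿inverse = negate-inverseˡ , negate-inverseʳ
    }

  leftModule : LeftModule K.ring (k ⊔ x) (k ⊔ ℓk ⊔ x ⊔ ℓx)
  leftModule = record { isLeftModule = isLeftModule }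

  linearExtension : ∀ {m ℓm} (M : LeftModule K.ring m ℓm) →
                    (X.Carrier → LeftModule.Carrierᴹ M) →
                    FormalSum → LeftModule.Carrierᴹ M
  linearExtension M f = List.foldr (λ (a , y) v → (a *ₗ f y) +ᴹ v) 0ᴹ
    where open LeftModule M

module MonoidAlgebra {k ℓk m ℓm} (K : CommutativeRing k ℓk) (M : CommutativeMonoid m ℓm) where
  private
    module K = CommutativeRing K
    module M = CommutativeMonoid M
  open FreeModule K M.setoid

  term* : K.Carrier × M.Carrier → FormalSum → FormalSum
  term* (a , x) = List.map (λ (b , y) → (a K.* b , x M.∙ y))

  infixl 7 _⊛_
  _⊛_ : FormalSum → FormalSum → FormalSum
  u ⊛ v = List.concatMap (λ t → term* t v) u

  term*-++ : ∀ t u v → term* t (u ++ v) ≡ term* t u ++ term* t v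
  term*-++ t u v = map-++ _ u v

  term*-congʳ : ∀ t {u v} → u ≋ v → term* t u ≋ term* t v
  term*-congʳ t ≋-refl          = ≋-refl
  term*-congʳ t (≋-sym p)       = ≋-sym (term*-congʳ t p)
  term*-congʳ t (≋-trans p q)   = ≋-trans (term*-congʳ t p) (term*-congʳ t q)
  term*-congʳ t (∷-cong a≈b y≈z p) =
    ∷-cong (K.*-congˡ a≈b) (M.∙-congˡ y≈z) (term*-congʳ t p)
  term*-congʳ t (swap s s′)     = swap _ _
  term*-congʳ (a , x) (collect b c y) =
    ≋-trans (collect _ _ _) (∷-cong (K.sym (K.distribˡ a b c)) M.refl ≋-refl)
  term*-congʳ (a , x) (drop y)  = drop≈ _ (K.zeroʳ a)

  term*-congˡ : ∀ {a b x y} u → a K.≈ b → x M.≈ y → term* (a , x) u ≋ term* (b , y) u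
  term*-congˡ []      a≈b x≈y = ≋-refl
  term*-congˡ (t ∷ u) a≈b x≈y =
    ∷-cong (K.*-congʳ a≈b) (M.∙-congʳ x≈y) (term*-congˡ u a≈b x≈y)

  term*-collect : ∀ a b x u → term* (a , x) u ++ term* (b , x) u ≋ term* (a K.+ b , x) u
  term*-collect a b x []            = ≋-refl
  term*-collect a b x ((c , y) ∷ u) = begin
    (a K.* c , x M.∙ y) ∷ (term* (a , x) u ++ (b K.* c , x M.∙ y) ∷ term* (b , x) u)
      ≈⟨ ∷-congʳ _ (++-shift _ (term* (a , x) u) _) ⟨
    (a K.* c , x M.∙ y) ∷ (b K.* c , x M.∙ y) ∷ (term* (a , x) u ++ term* (b , x) u)
      ≈⟨ collect _ _ _ ⟩
    (a K.* c K.+ b K.* c , x M.∙ y) ∷ (term* (a , x) u ++ term* (b , x) u)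
      ≈⟨ ∷-cong (K.sym (K.distribʳ c a b)) M.refl (term*-collect a b x u) ⟩
    ((a K.+ b) K.* c , x M.∙ y) ∷ term* (a K.+ b , x) u ∎
    where open SetoidReasoning ≋-setoid

  term*-zero : ∀ x u → term* (K.0# , x) u ≋ []
  term*-zero x []            = ≋-refl
  term*-zero x ((c , y) ∷ u) = ≋-trans (drop≈ _ (K.zeroˡ c)) (term*-zero x u)

  ⊛-congˡ : ∀ {u v} w → u ≋ v → u ⊛ w ≋ v ⊛ w
  ⊛-congˡ w ≋-refl        = ≋-refl
  ⊛-congˡ w (≋-sym p)     = ≋-sym (⊛-congˡ w p)
  ⊛-congˡ w (≋-trans p q) = ≋-trans (⊛-congˡ w p) (⊛-congˡ w q)
  ⊛-congˡ w (∷-cong a≈b y≈z p) = ++-cong (term*-congˡ w a≈b y≈z) (⊛-congˡ w p)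
  ⊛-congˡ w (swap s t {u}) = begin
    term* s w ++ (term* t w ++ u ⊛ w)  ≡⟨ ++-assoc (term* s w) _ _ ⟨
    (term* s w ++ term* t w) ++ u ⊛ w  ≈⟨ ++-congˡ _ (++-comm (term* s w) _) ⟩
    (term* t w ++ term* s w) ++ u ⊛ w  ≡⟨ ++-assoc (term* t w) _ _ ⟩
    term* t w ++ (term* s w ++ u ⊛ w)  ∎
    where open SetoidReasoning ≋-setoid
  ⊛-congˡ w (collect a b y) =
    ≋-trans (≡⇒≋ (sym (++-assoc (term* (a , y) w) _ _))) (++-congˡ _ (term*-collect a b y w))
  ⊛-congˡ w (drop y) = ++-congˡ _ (term*-zero y w)

  ⊛-congʳ : ∀ u {v w} → v ≋ w → u ⊛ v ≋ u ⊛ w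
  ⊛-congʳ []      p = ≋-refl
  ⊛-congʳ (t ∷ u) p = ++-cong (term*-congʳ t p) (⊛-congʳ u p)

  ⊛-cong : ∀ {u u′ v v′} → u ≋ u′ → v ≋ v′ → u ⊛ v ≋ u′ ⊛ v′
  ⊛-cong {u′ = u′} {v = v} p q = ≋-trans (⊛-congˡ v p) (⊛-congʳ u′ q)

  ⊛-distribʳ : ∀ w u v → (u ++ v) ⊛ w ≋ u ⊛ w ++ v ⊛ w
  ⊛-distribʳ w []      v = ≋-refl
  ⊛-distribʳ w (t ∷ u) v =
    ≋-trans (++-congʳ (term* t w) (⊛-distribʳ w u v)) (≡⇒≋ (sym (++-assoc (term* t w) _ _)))

  ⊛-distribˡ : ∀ w u v → w ⊛ (u ++ v) ≋ w ⊛ u ++ w ⊛ v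
  ⊛-distribˡ []      u v = ≋-refl
  ⊛-distribˡ (t ∷ w) u v =
    ≋-trans (++-cong (≡⇒≋ (term*-++ t u v)) (⊛-distribˡ w u v))
            (++-interchange (term* t u) (term* t v) (w ⊛ u) (w ⊛ v))

  term*-comm : ∀ t u → term* t u ≋ u ⊛ [ t ]
  term*-comm t             []            = ≋-refl
  term*-comm t@(a , x) ((b , y) ∷ u) = ∷-cong (K.*-comm a b) (M.comm x y) (term*-comm t u)

  ⊛-zeroʳ : ∀ u → u ⊛ [] ≋ []
  ⊛-zeroʳ []      = ≋-refl
  ⊛-zeroʳ (t ∷ u) = ⊛-zeroʳ u

  ⊛-comm : ∀ u v → u ⊛ v ≋ v ⊛ u
  ⊛-comm []      v = ≋-sym (⊛-zeroʳ v)
  ⊛-comm (t ∷ u) v =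
    ≋-trans (++-cong (term*-comm t v) (⊛-comm u v)) (≋-sym (⊛-distribˡ v [ t ] u))

  term*-term* : ∀ a x b y u → term* (a K.* b , x M.∙ y) u ≋ term* (a , x) (term* (b , y) u)
  term*-term* a x b y []            = ≋-refl
  term*-term* a x b y ((c , z) ∷ u) =
    ∷-cong (K.*-assoc a b c) (M.assoc x y z) (term*-term* a x b y u)

  term*-⊛ : ∀ t u v → term* t u ⊛ v ≋ term* t (u ⊛ v)
  term*-⊛ t       []            v = ≋-refl
  term*-⊛ (a , x) ((b , y) ∷ u) v =
    ≋-trans (++-cong (term*-term* a x b y v) (term*-⊛ (a , x) u v))
            (≡⇒≋ (sym (term*-++ (a , x) (term* (b , y) v) (u ⊛ v))))

  ⊛-assoc : ∀ u v w → (u ⊛ v) ⊛ w ≋ u ⊛ (v ⊛ w)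
  ⊛-assoc []      v w = ≋-refl
  ⊛-assoc (t ∷ u) v w =
    ≋-trans (⊛-distribʳ w (term* t v) (u ⊛ v)) (++-cong (term*-⊛ t v w) (⊛-assoc u v w))

  ⊛-identityˡ : ∀ u → basis M.ε ⊛ u ≋ u
  ⊛-identityˡ u = ≋-trans (≡⇒≋ (++-identityʳ _)) (go u)
    where
    go : ∀ u → term* (K.1# , M.ε) u ≋ u
    go []            = ≋-refl
    go ((b , y) ∷ u) = ∷-cong (K.*-identityˡ b) (M.identityˡ y) (go u)

  ⊛-identityʳ : ∀ u → u ⊛ basis M.ε ≋ u
  ⊛-identityʳ u = ≋-trans (⊛-comm u (basis M.ε)) (⊛-identityˡ u)

  scale-⊛ : ∀ a u v → scale a u ⊛ v ≋ scale a (u ⊛ v)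
  scale-⊛ a []            v = ≋-refl
  scale-⊛ a ((b , x) ∷ u) v =
    ≋-trans (++-cong (go v) (scale-⊛ a u v))
            (≡⇒≋ (sym (map-++ (map₁ (a K.*_)) (term* (b , x) v) (u ⊛ v))))
    where
    go : ∀ v → term* (a K.* b , x) v ≋ scale a (term* (b , x) v)
    go []            = ≋-refl
    go ((c , y) ∷ v) = ∷-cong (K.*-assoc a b c) M.refl (go v)

  isCommutativeRing : IsCommutativeRing _≋_ _++_ _⊛_ negate [] (basis M.ε)
  isCommutativeRing = record
    { isRing = record
      { +-isAbelianGroup = LeftModule.+ᴹ-isAbelianGroup leftModule
      ; *-cong           = ⊛-cong
      ; *-assoc          = ⊛-assoc
      ; *-identity       = ⊛-identityˡ , ⊛-identityʳ
      ; distrib          = ⊛-distribˡ , ⊛-distribʳ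
      }
    ; *-comm = ⊛-comm
    }

  commutativeAlgebra : CommutativeAlgebra K (k ⊔ m) (k ⊔ ℓk ⊔ m ⊔ ℓm)
  commutativeAlgebra = record
    { commutativeRing = record { isCommutativeRing = isCommutativeRing }
    ; _*ₗ_            = scale
    ; isLeftModule    = isLeftModule
    ; *ₗ-*-assoc      = scale-⊛
    }

-- An enumeration is part of the data, but morphisms are arbitrary bijections
-- of carriers, so different enumerations of a set give isomorphic objects.
record FinSet : Set₁ where
  no-eta-equality
  field
    Carrier : Set
    card    : ℕ
    enum    : Carrier ↔ Fin card

open FinSet using (Carrier)

infix 4 _≅_
_≅_ : FinSet → FinSet → Set
E ≅ F = Carrier E ↔ Carrier F

∅ : FinSet
∅ = record { Carrier = Fin 0 ; card = 0 ; enum = ↔-id (Fin 0) }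

-- Subsets are given by their Boolean characteristic functions.
record Sub (E : FinSet) : Set where
  constructor sub
  infix 5 _∋ᵇ_
  field
    _∋ᵇ_ : Carrier E → Bool

open Sub public

module _ {E : FinSet} where

  infix 4 _∈_ _⊆_
  infixr 6 _∪_

  _∈_ : Carrier E → Sub E → Set
  e ∈ A = T (A ∋ᵇ e)

  _⊆_ : Sub E → Sub E → Set
  A ⊆ B = ∀ e → e ∈ A → e ∈ B

  full empty : Sub E
  full  = sub λ _ → true
  empty = sub λ _ → false

  ∁ : Sub E → Sub E
  ∁ A = sub λ e → not (A ∋ᵇ e)

  _∪_ : Sub E → Sub E → Sub E
  A ∪ B = sub λ e → (A ∋ᵇ e) ∨ (B ∋ᵇ e)

  Disjoint : Sub E → Sub E → Set
  Disjoint A B = ∀ e → e ∈ A → ¬ (e ∈ B)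

  ⁅_⁆ : Carrier E → Sub E
  ⁅ e ⁆ = sub λ f → does (to e Fin.≟ to f)
    where open Inverse (FinSet.enum E)

member-≡ : ∀ {E : Set} (A : E → Bool) {x y : Σ E (T ∘ A)} → proj₁ x ≡ proj₁ y → x ≡ y
member-≡ A {e , p} {.e , q} refl = cong (e ,_) (T-irrelevant p q)

restrict↔ : ∀ {E F : Set} (σ : E ↔ F) (A : E → Bool) (B : F → Bool) →
            A ≗ B ∘ Inverse.to σ → Σ E (T ∘ A) ↔ Σ F (T ∘ B)
restrict↔ σ A B A≗B = mk↔ₛ′
  (λ (e , p) → σ.to e , subst T (A≗B e) p)
  (λ (f , q) → σ.from f , subst T (sym (A≗Bfrom f)) q)
  (λ (f , q) → member-≡ B (σ.strictlyInverseˡ f))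
  (λ (e , p) → member-≡ A (σ.strictlyInverseʳ e))
  where
  module σ = Inverse σ
  A≗Bfrom : ∀ f → A (σ.from f) ≡ B f
  A≗Bfrom f = trans (A≗B (σ.from f)) (cong B (σ.strictlyInverseˡ f))

countFin : ∀ n → (Fin n → Bool) → ℕ
countFin zero    A = 0
countFin (suc n) A = (if A zero then 1 else 0) ℕ.+ countFin n (A ∘ suc)

enumFin : ∀ n (A : Fin n → Bool) → Σ (Fin n) (T ∘ A) ↔ Fin (countFin n A)
enumFin zero    A = mk↔ₛ′ (λ ()) (λ ()) (λ ()) (λ ())
enumFin (suc n) A = ↔-sym Fin.+↔⊎ ↔-∘ ((first (A zero) ⊎-↔ enumFin n (A ∘ suc)) ↔-∘ split)
  where
  first : ∀ b → T b ↔ Fin (if b then 1 else 0)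
  first true  = ↔-sym Fin.1↔⊤
  first false = ↔-sym Fin.0↔⊥

  split : Σ (Fin (suc n)) (T ∘ A) ↔ (T (A zero) ⊎ Σ (Fin n) (T ∘ A ∘ suc))
  split = mk↔ₛ′
    (λ { (zero , p) → inj₁ p ; (suc i , p) → inj₂ (i , p) })
    (λ { (inj₁ p) → zero , p ; (inj₂ (i , p)) → suc i , p })
    (λ { (inj₁ p) → refl ; (inj₂ (i , p)) → refl })
    (λ { (zero , p) → refl ; (suc i , p) → refl })

⟪_⟫ : ∀ {E} → Sub E → FinSet
⟪_⟫ {E} A = record
  { Carrier = Σ (Carrier E) (_∈ A)
  ; card    = countFin card ((A ∋ᵇ_) ∘ from)
  ; enum    = enumFin card ((A ∋ᵇ_) ∘ from) ↔-∘
              restrict↔ enum (A ∋ᵇ_) ((A ∋ᵇ_) ∘ from)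
                (λ e → cong (A ∋ᵇ_) (sym (strictlyInverseʳ e)))
  }
  where
  open FinSet E using (card; enum)
  open Inverse enum

-- B ∩ A as a subset of A; it is B itself when B ⊆ A.
infixl 7 _∩ˢ_
_∩ˢ_ : ∀ {E} (B A : Sub E) → Sub ⟪ A ⟫
B ∩ˢ A = sub λ (e , _) → B ∋ᵇ e

-- A subset of a subset of E is not literally a subset of E; the laws of a
-- minors system are stated along the following bijections, all of which
-- leave the underlying elements of E unchanged.
module Canonical {E : FinSet} where

  flatten : (A : Sub E) (C : Sub ⟪ A ⟫) (D : Sub E) →
            (∀ x → (C ∋ᵇ x) ≡ (D ∋ᵇ proj₁ x)) → D ⊆ A → ⟪ C ⟫ ≅ ⟪ D ⟫
  flatten A C D C≗D D⊆A = mk↔ₛ′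
    (λ (x , c) → proj₁ x , subst T (C≗D x) c)
    (λ (e , d) → (e , D⊆A e d) , subst T (sym (C≗D (e , D⊆A e d))) d)
    (λ (e , d) → member-≡ (D ∋ᵇ_) refl)
    (λ (x , c) → member-≡ (C ∋ᵇ_) (member-≡ (A ∋ᵇ_) refl))

  full≅ : ⟪ full {E} ⟫ ≅ E
  full≅ = mk↔ₛ′ proj₁ (λ e → e , tt) (λ _ → refl) (λ _ → refl)

  ∁empty≅ : ⟪ ∁ (empty {E}) ⟫ ≅ E
  ∁empty≅ = mk↔ₛ′ proj₁ (λ e → e , tt) (λ _ → refl) (λ _ → refl)

  -- A, as a subset of A ⊔ B
  left≅ : (A B : Sub E) → ⟪ A ∩ˢ (A ∪ B) ⟫ ≅ ⟪ A ⟫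
  left≅ A B = flatten (A ∪ B) (A ∩ˢ (A ∪ B)) A (λ _ → refl) incl
    where
    incl : A ⊆ A ∪ B
    incl e p with A ∋ᵇ e
    ... | true = tt

  -- B, as a subset of E ∖ A
  right≅ : (A B : Sub E) → Disjoint A B → ⟪ B ∩ˢ ∁ A ⟫ ≅ ⟪ B ⟫
  right≅ A B disj = flatten (∁ A) (B ∩ˢ ∁ A) B (λ _ → refl) incl
    where
    incl : B ⊆ ∁ A
    incl e q with A ∋ᵇ e | disj e
    ... | true  | d = d tt q
    ... | false | _ = tt

  -- (A ⊔ B) ∖ A = B
  ∁left≅ : (A B : Sub E) → Disjoint A B → ⟪ ∁ (A ∩ˢ (A ∪ B)) ⟫ ≅ ⟪ B ⟫
  ∁left≅ A B disj = flatten (A ∪ B) (∁ (A ∩ˢ (A ∪ B))) B (λ (e , p) → eq e p) incl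
    where
    eq : ∀ e → e ∈ A ∪ B → not (A ∋ᵇ e) ≡ (B ∋ᵇ e)
    eq e p with A ∋ᵇ e | B ∋ᵇ e | disj e
    ... | true  | true  | d = ⊥-elim (d tt tt)
    ... | true  | false | _ = refl
    ... | false | true  | _ = refl
    incl : B ⊆ A ∪ B
    incl e q with A ∋ᵇ e | B ∋ᵇ e
    ... | true  | true = tt
    ... | false | true = tt

  -- (E ∖ A) ∖ B = E ∖ (A ⊔ B)
  ∁∁≅ : (A B : Sub E) → ⟪ ∁ (B ∩ˢ ∁ A) ⟫ ≅ ⟪ ∁ (A ∪ B) ⟫
  ∁∁≅ A B = flatten (∁ A) (∁ (B ∩ˢ ∁ A)) (∁ (A ∪ B)) (λ (e , p) → eq e p) incl
    where
    eq : ∀ e → e ∈ ∁ A → not (B ∋ᵇ e) ≡ not ((A ∋ᵇ e) ∨ (B ∋ᵇ e))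
    eq e p with A ∋ᵇ e
    ... | false = refl
    incl : ∁ (A ∪ B) ⊆ ∁ A
    incl e p with A ∋ᵇ e
    ... | false = tt

  -- A ∖ A = ∅
  ∁self≅ : (A : Sub E) → ⟪ ∁ (A ∩ˢ A) ⟫ ≅ ∅
  ∁self≅ A = mk↔ₛ′ (λ x → ⊥-elim (void x)) (λ ()) (λ ()) (λ x → ⊥-elim (void x))
    where
    void : Carrier ⟪ ∁ (A ∩ˢ A) ⟫ → ⊥
    void ((e , p) , q) with A ∋ᵇ e
    ... | true  = q
    ... | false = p

subsetsFin : ∀ n → List (Subset n)
subsetsFin zero    = [ Vec.[] ]
subsetsFin (suc n) = List.map (outside Vec.∷_) (subsetsFin n) ++
                     List.map (inside Vec.∷_) (subsetsFin n)

subsets : (E : FinSet) → List (Sub E)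
subsets E = List.map (λ s → sub λ e → lookup s (to e)) (subsetsFin card)
  where
  open FinSet E using (card; enum)
  open Inverse enum

record SetSpecies (c ℓ : Level) : Set (lsuc (0ℓ ⊔ c ⊔ ℓ)) where
  field
    obj : FinSet → Setoid c ℓ

  S[_] : FinSet → Set c
  S[ E ] = Setoid.Carrier (obj E)

  infix 4 _≈_
  _≈_ : ∀ {E} → S[ E ] → S[ E ] → Set ℓ
  _≈_ {E} = Setoid._≈_ (obj E)

  field
    map      : ∀ {E F} → E ≅ F → S[ E ] → S[ F ]
    map-cong : ∀ {E F} {σ τ : E ≅ F} {X Y : S[ E ]} →
               Inverse.to σ ≗ Inverse.to τ → X ≈ Y → map {E} {F} σ X ≈ map τ Y
    map-id   : ∀ {E} (X : S[ E ]) → map {E} {E} (↔-id (Carrier E)) X ≈ X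
    map-∘    : ∀ {E F G} (τ : F ≅ G) (σ : E ≅ F) (X : S[ E ]) →
               map {E} {G} (τ ↔-∘ σ) X ≈ map {F} {G} τ (map {E} {F} σ X)

module LinearSpecies {k ℓk c ℓ} (K : CommutativeRing k ℓk) (S : SetSpecies c ℓ) where
  private module K = CommutativeRing K
  open SetSpecies S

  KS[_] : FinSet → LeftModule K.ring (k ⊔ c) (k ⊔ ℓk ⊔ c ⊔ ℓ)
  KS[ E ] = FreeModule.leftModule K (obj E)

  ∣KS[_]∣ : FinSet → Set (k ⊔ c)
  ∣KS[ E ]∣ = LeftModule.Carrierᴹ KS[ E ]

  Kmap : ∀ {E F} → E ≅ F → ∣KS[ E ]∣ → ∣KS[ F ]∣
  Kmap {E} {F} σ = List.map (map₂ (map {E} {F} σ))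

  structure : ∀ {E} → S[ E ] → ∣KS[ E ]∣
  structure {E} = FreeModule.basis K (obj E)

  -- Naturality into the constant species R is invariance under bijections.
  record Morphism {r ℓr} (R : LeftModule K.ring r ℓr) : Set (lsuc 0ℓ ⊔ k ⊔ ℓk ⊔ c ⊔ ℓ ⊔ r ⊔ ℓr) where
    private module R = LeftModule R
    field
      ⟦_⟧ : ∀ {E} → ∣KS[ E ]∣ → R.Carrierᴹ
      isLinear : ∀ {E} → ModuleMorphism.LeftModuleMorphisms.IsLeftModuleHomomorphism
                   (LeftModule.rawLeftModule KS[ E ]) R.rawLeftModule (⟦_⟧ {E})
      invariant : ∀ {E F} (σ : E ≅ F) (x : ∣KS[ E ]∣) →
                  ⟦_⟧ {F} (Kmap {E} {F} σ x) R.≈ᴹ ⟦_⟧ {E} x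

record MinorsSystem (c ℓ : Level) : Set (lsuc (0ℓ ⊔ c ⊔ ℓ)) where
  field
    species : SetSpecies c ℓ
  open SetSpecies species public
  infixl 7 _∣_ _/_
  infixl 6 _⊕_
  field
    _∣_ : ∀ {E} → S[ E ] → (A : Sub E) → S[ ⟪ A ⟫ ]
    _/_ : ∀ {E} → S[ E ] → (A : Sub E) → S[ ⟪ ∁ A ⟫ ]
    _⊕_ : ∀ {E} → S[ E ] → S[ ∅ ] → S[ E ]

    ∣-cong : ∀ {E} {X Y : S[ E ]} (A : Sub E) → X ≈ Y → X ∣ A ≈ Y ∣ A
    /-cong : ∀ {E} {X Y : S[ E ]} (A : Sub E) → X ≈ Y → X / A ≈ Y / A
    ⊕-cong : ∀ {E} {X X′ : S[ E ]} {Y Y′ : S[ ∅ ]} → X ≈ X′ → Y ≈ Y′ → X ⊕ Y ≈ X′ ⊕ Y′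

    -- The hypothesis on A and B says B = σ(A).  With σ the identity, this
    -- also says that X ∣ A and X / A depend only on the elements of A.
    map-∣ : ∀ {E F} (σ : E ≅ F) (A : Sub E) (B : Sub F) (A≗B : (A ∋ᵇ_) ≗ (B ∋ᵇ_) ∘ Inverse.to σ) (X : S[ E ]) →
            map {⟪ A ⟫} {⟪ B ⟫} (restrict↔ σ (A ∋ᵇ_) (B ∋ᵇ_) A≗B) (X ∣ A) ≈ map σ X ∣ B
    map-/ : ∀ {E F} (σ : E ≅ F) (A : Sub E) (B : Sub F) (A≗B : (A ∋ᵇ_) ≗ (B ∋ᵇ_) ∘ Inverse.to σ) (X : S[ E ]) →
            map {⟪ ∁ A ⟫} {⟪ ∁ B ⟫} (restrict↔ σ (∁ A ∋ᵇ_) (∁ B ∋ᵇ_) (λ e → cong not (A≗B e))) (X / A)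
              ≈ map σ X / B
    map-⊕ : ∀ {E F} (σ : E ≅ F) (X : S[ E ]) (Y : S[ ∅ ]) →
            map {E} {F} σ (X ⊕ Y) ≈ map σ X ⊕ Y

    ∣-∣ : ∀ {E} (A B : Sub E) → Disjoint A B → (X : S[ E ]) →
          map (Canonical.left≅ A B) ((X ∣ (A ∪ B)) ∣ (A ∩ˢ (A ∪ B))) ≈ X ∣ A
    /-∣ : ∀ {E} (A B : Sub E) (disj : Disjoint A B) (X : S[ E ]) →
          map {F = ⟪ B ⟫} (Canonical.right≅ A B disj) ((X / A) ∣ (B ∩ˢ ∁ A))
            ≈ map {F = ⟪ B ⟫} (Canonical.∁left≅ A B disj) ((X ∣ (A ∪ B)) / (A ∩ˢ (A ∪ B)))
    /-/ : ∀ {E} (A B : Sub E) → Disjoint A B → (X : S[ E ]) →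
          map (Canonical.∁∁≅ A B) ((X / A) / (B ∩ˢ ∁ A)) ≈ X / (A ∪ B)

    ∣-full  : ∀ {E} (X : S[ E ]) → map {F = E} (Canonical.full≅ {E}) (X ∣ full) ≈ X
    /-empty : ∀ {E} (X : S[ E ]) → map {F = E} (Canonical.∁empty≅ {E}) (X / empty) ≈ X

    ⊕-assoc : ∀ {E} (X : S[ E ]) (Y Z : S[ ∅ ]) → X ⊕ (Y ⊕ Z) ≈ (X ⊕ Y) ⊕ Z
    ⊕-comm  : ∀ (X Y : S[ ∅ ]) → X ⊕ Y ≈ Y ⊕ X

    1ₛ         : S[ ∅ ]
    ⊕-identity : ∀ {E} (X : S[ E ]) → X ⊕ 1ₛ ≈ X

    ⊕-∣ : ∀ {E} (X : S[ E ]) (Y : S[ ∅ ]) (A : Sub E) → (X ⊕ Y) ∣ A ≈ (X ∣ A) ⊕ Y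
    ⊕-/ : ∀ {E} (X : S[ E ]) (Y : S[ ∅ ]) (A : Sub E) → (X ⊕ Y) / A ≈ (X / A) ⊕ Y

  infixl 7 _∖_
  _∖_ : ∀ {E} → S[ E ] → (A : Sub E) → S[ ⟪ ∁ A ⟫ ]
  X ∖ A = X ∣ ∁ A

  -- (X ∣ A) / A, which lives over the empty set A ∖ A
  _∣_/self : ∀ {E} → S[ E ] → Sub E → S[ ∅ ]
  X ∣ A /self = map (Canonical.∁self≅ A) ((X ∣ A) / (A ∩ˢ A))

  S∅-commutativeMonoid : CommutativeMonoid c ℓ
  S∅-commutativeMonoid = record
    { Carrier = S[ ∅ ]
    ; _≈_     = _≈_
    ; _∙_     = _⊕_
    ; ε       = 1ₛ
    ; isCommutativeMonoid = record
      { isMonoid = record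
        { isSemigroup = record
          { isMagma = record
            { isEquivalence = Setoid.isEquivalence (obj ∅)
            ; ∙-cong        = ⊕-cong
            }
          ; assoc = λ X Y Z → S∅.sym (⊕-assoc X Y Z)
          }
        ; identity = (λ X → S∅.trans (⊕-comm 1ₛ X) (⊕-identity X)) , ⊕-identity
        }
      ; comm = ⊕-comm
      }
    }
    where module S∅ = Setoid (obj ∅)

record Norm {c ℓ u ℓu} (S : MinorsSystem c ℓ) (U : CommutativeMonoid u ℓu)
       : Set (lsuc 0ℓ ⊔ c ⊔ ℓ ⊔ u ⊔ ℓu) where
  open MinorsSystem S
  private module U = CommutativeMonoid U
  field
    N           : ∀ {E} → S[ E ] → U.Carrier
    N-cong      : ∀ {E} {X Y : S[ E ]} → X ≈ Y → N X U.≈ N Y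
    N-invariant : ∀ {E F} (σ : E ≅ F) (X : S[ E ]) → N (map {E} {F} σ X) U.≈ N X
    N-minors    : ∀ {E} (X : S[ E ]) (A : Sub E) → N X U.≈ N (X ∣ A) U.∙ N (X / A)
    N-⊕         : ∀ {E} (X : S[ E ]) (Y : S[ ∅ ]) → N (X ⊕ Y) U.≈ N X
    N-1         : N 1ₛ U.≈ U.ε

module _ {k ℓk c ℓ r ℓr} {K : CommutativeRing k ℓk} {S : MinorsSystem c ℓ}
         (R : CommutativeAlgebra K r ℓr) where
  open MinorsSystem S
  open LinearSpecies K species

  linearNorm : Norm S (CommutativeAlgebra.*-commutativeMonoid R) →
               ∀ {E} → ∣KS[ E ]∣ → CommutativeAlgebra.Carrier R
  linearNorm N {E} =
    FreeModule.linearExtension K (obj E) (CommutativeAlgebra.leftModule R) (Norm.N N)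

module GrothendieckMonoid {c ℓ} (S : MinorsSystem c ℓ) where
  open MinorsSystem S

  infixl 7 _·_
  data Word : Set (lsuc 0ℓ ⊔ c) where
    ⟨_⟩ : ∀ {E} → S[ E ] → Word
    ε   : Word
    _·_ : Word → Word → Word

  infix 4 _∼_
  data _∼_ : Word → Word → Set (lsuc 0ℓ ⊔ c ⊔ ℓ) where
    ∼-refl     : ∀ {w} → w ∼ w
    ∼-sym      : ∀ {w v} → w ∼ v → v ∼ w
    ∼-trans    : ∀ {w v z} → w ∼ v → v ∼ z → w ∼ z
    ·-cong     : ∀ {w w′ v v′} → w ∼ w′ → v ∼ v′ → w · v ∼ w′ · v′
    ·-assoc    : ∀ w v z → (w · v) · z ∼ w · (v · z)
    ·-identity : ∀ w → ε · w ∼ w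
    ·-comm     : ∀ w v → w · v ∼ v · w
    iso        : ∀ {E F} (σ : E ≅ F) {X : S[ E ]} {Y : S[ F ]} →
                 map {E} {F} σ X ≈ Y → ⟨_⟩ {E} X ∼ ⟨_⟩ {F} Y
    minors     : ∀ {E} (X : S[ E ]) (A : Sub E) →
                 ⟨_⟩ {E} X ∼ ⟨_⟩ {⟪ A ⟫} (X ∣ A) · ⟨_⟩ {⟪ ∁ A ⟫} (X / A)
    sum        : ∀ {E} (X : S[ E ]) (Y : S[ ∅ ]) → ⟨_⟩ {E} (X ⊕ Y) ∼ ⟨_⟩ {E} X
    unit       : ⟨_⟩ {∅} 1ₛ ∼ ε

  U : CommutativeMonoid (lsuc 0ℓ ⊔ c) (lsuc 0ℓ ⊔ c ⊔ ℓ)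
  U = record
    { Carrier = Word
    ; _≈_     = _∼_
    ; _∙_     = _·_
    ; ε       = ε
    ; isCommutativeMonoid = record
      { isMonoid = record
        { isSemigroup = record
          { isMagma = record
            { isEquivalence = record { refl = ∼-refl ; sym = ∼-sym ; trans = ∼-trans }
            ; ∙-cong        = ·-cong
            }
          ; assoc = ·-assoc
          }
        ; identity = ·-identity , (λ w → ∼-trans (·-comm w ε) (·-identity w))
        }
      ; comm = ·-comm
      }
    }

module UniversalTutteCharacter {k ℓk c ℓ} (K : CommutativeRing k ℓk) (S : MinorsSystem c ℓ) where
  open MinorsSystem S
  open LinearSpecies K species
  open GrothendieckMonoid S using (U; ⟨_⟩)

  U×S∅×U : CommutativeMonoid (lsuc 0ℓ ⊔ c) (lsuc 0ℓ ⊔ c ⊔ ℓ)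
  U×S∅×U = DirectProduct.commutativeMonoid U (DirectProduct.commutativeMonoid S∅-commutativeMonoid U)

  K[U×S∅×U] : CommutativeAlgebra K (k ⊔ lsuc 0ℓ ⊔ c) (k ⊔ ℓk ⊔ lsuc 0ℓ ⊔ c ⊔ ℓ)
  K[U×S∅×U] = MonoidAlgebra.commutativeAlgebra K U×S∅×U

  private
    module KU = CommutativeAlgebra K[U×S∅×U]
    module KUbasis = FreeModule K (CommutativeMonoid.setoid U×S∅×U)

  tutteSum : ∀ {E} → S[ E ] → KU.Carrier
  tutteSum {E} X = List.foldr KU._+_ KU.0# (List.map term (subsets E))
    where
    term : Sub E → KU.Carrier
    term A = KUbasis.basis
      (⟨_⟩ {⟪ A ⟫} (X ∣ A) , X ∣ A /self , ⟨_⟩ {⟪ ∁ A ⟫} (X / A))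

  T^S : ∀ {E} → ∣KS[ E ]∣ → KU.Carrier
  T^S {E} = FreeModule.linearExtension K (obj E) KU.leftModule (tutteSum {E})

{-# OPTIONS --safe #-}
module Submission where

-- The wanted character is Φ̄([X], Y, [Z]) = N₁(X) Φ(Y) N₂(Z), so everything reduces to
--   Φ(X) = Σ_{A ⊆ E} N₁(X|A) Φ((X|A)/A) N₂(X/A),
-- by induction on |E|.  If D ⊆ A, the A-summand for X is N₁(X|D) times the (A∖D)-summand for
-- X/D; if A ⊆ D, it is N₂(X/D) times the A-summand for X|D.  Taking D = {e} and D = E∖{e}, the
-- subsets with and without e sum to the two terms of the deletion-contraction relation.  For
-- E = ∅ the norms are trivial: N(X) = N(X ⊕ 1) = N(1 ⊕ X) = N(1) = 1.

open import Algebra.Bundles using (CommutativeMonoid; CommutativeRing; CommutativeSemiring)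
open import Algebra.Module.Bundles using (LeftModule)
import Algebra.Module.Morphism.Structures as ModuleMorphism
import Algebra.Morphism.Structures as Morphisms
import Algebra.Properties.CommutativeSemigroup as CommutativeSemigroupProperties
import Algebra.Properties.Group as GroupProperties
open import Data.Bool.Base using (true; false; not; _∧_; T)
open import Data.Bool.Properties using (T-≡; not-involutive)
open import Data.Empty using (⊥-elim)
open import Data.Fin.Base using (Fin; zero; suc; punchOut)
import Data.Fin.Properties as Fin
open import Data.Fin.Subset using (Subset; inside; outside)
open import Data.List.Base as List using (List; []; _∷_; _++_)
open import Data.Nat.Base using (zero; suc)
open import Data.Product.Base using (Σ-syntax; _,_; proj₁)
open import Data.Unit.Base using (tt)
open import Data.Vec.Base as Vec using (lookup)
open import Defs
open import Function.Base using (_∘_)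
open import Function.Bundles using (_↔_; Equivalence; Injection; Inverse; mk↔ₛ′)
open import Function.Construct.Composition using (_↔-∘_)
open import Function.Construct.Identity using (↔-id)
open import Function.Construct.Symmetry using (↔-sym)
open import Function.Properties.Inverse using (↔⇒↣)
open import Relation.Binary.Bundles using (Setoid)
open import Relation.Binary.PropositionalEquality as ≡ using (_≡_; _≢_; _≗_; refl; cong; subst)
import Relation.Binary.Reasoning.Setoid as SetoidReasoning
open import Relation.Nullary using (¬_)
open import Relation.Nullary.Decidable using (yes; dec-true)

open FinSet using (Carrier; enum)

-- Linear maps out of a free module.

module LinearExtension {k ℓk x ℓx m ℓm} (K : CommutativeRing k ℓk) (X : Setoid x ℓx)
                       (M : LeftModule (CommutativeRing.ring K) m ℓm) where
  private
    module K = CommutativeRing K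
    module X = Setoid X
  open FreeModule K X
  open LeftModule M
  open SetoidReasoning ≈ᴹ-setoid
  open CommutativeSemigroupProperties
    (CommutativeMonoid.commutativeSemigroup +ᴹ-commutativeMonoid) using (x∙yz≈y∙xz)

  module _ (g : X.Carrier → Carrierᴹ) where
    private
      ext : FormalSum → Carrierᴹ
      ext = linearExtension M g

    -- Equality of formal sums is a generated congruence, so well-definedness is a check on
    -- generators: each of them becomes a module law.
    ext-cong : (∀ {y z} → y X.≈ z → g y ≈ᴹ g z) → ∀ {u v} → u ≋ v → ext u ≈ᴹ ext v
    ext-cong g-cong = go
      where
      go : ∀ {u v} → u ≋ v → ext u ≈ᴹ ext v
      go ≋-refl             = ≈ᴹ-refl
      go (≋-sym p)          = ≈ᴹ-sym (go p)
      go (≋-trans p q)      = ≈ᴹ-trans (go p) (go q)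
      go (∷-cong a≈b y≈z p) = +ᴹ-cong (*ₗ-cong a≈b (g-cong y≈z)) (go p)
      go (swap s t)         = x∙yz≈y∙xz _ _ _
      go (collect a b y)    =
        ≈ᴹ-trans (≈ᴹ-sym (+ᴹ-assoc _ _ _)) (+ᴹ-congʳ (≈ᴹ-sym (*ₗ-distribʳ (g y) a b)))
      go (drop y)           = ≈ᴹ-trans (+ᴹ-congʳ (*ₗ-zeroˡ (g y))) (+ᴹ-identityˡ _)

    ext-++ : ∀ u v → ext (u ++ v) ≈ᴹ ext u +ᴹ ext v
    ext-++ []            v = ≈ᴹ-sym (+ᴹ-identityˡ _)
    ext-++ ((a , y) ∷ u) v = ≈ᴹ-trans (+ᴹ-congˡ (ext-++ u v)) (≈ᴹ-sym (+ᴹ-assoc _ _ _))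

    ext-scale : ∀ a u → ext (scale a u) ≈ᴹ a *ₗ ext u
    ext-scale a []            = ≈ᴹ-sym (*ₗ-zeroʳ a)
    ext-scale a ((b , y) ∷ u) =
      ≈ᴹ-trans (+ᴹ-cong (*ₗ-assoc a b (g y)) (ext-scale a u)) (≈ᴹ-sym (*ₗ-distribˡ a _ _))

    ext-negate : (∀ {y z} → y X.≈ z → g y ≈ᴹ g z) → ∀ u → ext (negate u) ≈ᴹ -ᴹ ext u
    ext-negate g-cong u = inverseˡ-unique _ _ (begin
      ext (negate u) +ᴹ ext u  ≈⟨ ext-++ (negate u) u ⟨
      ext (negate u ++ u)      ≈⟨ ext-cong g-cong (negate-inverseˡ u) ⟩
      0ᴹ                       ∎)
      where open GroupProperties +ᴹ-group using (inverseˡ-unique)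

    ext-basis : ∀ y → ext (basis y) ≈ᴹ g y
    ext-basis y = ≈ᴹ-trans (+ᴹ-identityʳ _) (*ₗ-identityˡ (g y))

  homomorphism≈ext : ∀ {f} →
    ModuleMorphism.LeftModuleMorphisms.IsLeftModuleHomomorphism
      (LeftModule.rawLeftModule (FreeModule.leftModule K X)) rawLeftModule f →
    ∀ u → f u ≈ᴹ linearExtension M (f ∘ basis) u
  homomorphism≈ext {f} f-hom = go
    where
    open ModuleMorphism.LeftModuleMorphisms.IsLeftModuleHomomorphism f-hom
      renaming (*ₗ-homo to f-*ₗ; +ᴹ-homo to f-+ᴹ; 0ᴹ-homo to f-0ᴹ; ⟦⟧-cong to f-cong)
    go : ∀ u → f u ≈ᴹ linearExtension M (f ∘ basis) u
    go []            = f-0ᴹ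
    go ((a , y) ∷ u) = begin
      f ((a , y) ∷ u)
        -- The term `(a , y)` is `a` times a basis element only up to `a * 1# ≈ a`.
        ≈⟨ f-cong (∷-cong (K.sym (K.*-identityʳ a)) X.refl ≋-refl) ⟩
      f (scale a (basis y) ++ u)
        ≈⟨ f-+ᴹ (scale a (basis y)) u ⟩
      f (scale a (basis y)) +ᴹ f u
        ≈⟨ +ᴹ-cong (f-*ₗ a (basis y)) (go u) ⟩
      (a *ₗ f (basis y)) +ᴹ linearExtension M (f ∘ basis) u ∎

-- Algebra morphisms out of a monoid algebra.

module MonoidAlgebraExtension {k ℓk m ℓm r ℓr} (K : CommutativeRing k ℓk)
    (M : CommutativeMonoid m ℓm) (R : CommutativeAlgebra K r ℓr)
    {g : CommutativeMonoid.Carrier M → CommutativeAlgebra.Carrier R}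
    (g-hom : Morphisms.MonoidMorphisms.IsMonoidHomomorphism
       (CommutativeMonoid.rawMonoid M) (CommutativeAlgebra.*-rawMonoid R) g) where
  private
    module K = CommutativeRing K
    module M = CommutativeMonoid M
    module R = CommutativeAlgebra R
    module L = LeftModule R.leftModule
  open Morphisms.MonoidMorphisms.IsMonoidHomomorphism g-hom
    renaming (⟦⟧-cong to g-cong; homo to g-∙; ε-homo to g-ε)
  open FreeModule K M.setoid
  open MonoidAlgebra K M using (commutativeAlgebra; term*; _⊛_)
  open LinearExtension K M.setoid R.leftModule
  open SetoidReasoning R.setoid
  open CommutativeSemigroupProperties R.*-commutativeSemigroup using (x∙yz≈y∙xz)

  ext : FormalSum → R.Carrier
  ext = linearExtension R.leftModule g

  -- The algebra law `*ₗ-*-assoc` moves scalars across the left factor only; commutativity gives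
  -- access to the right one.
  *ₗ-interchange : ∀ a b x y → (a K.* b) R.*ₗ (x R.* y) R.≈ (a R.*ₗ x) R.* (b R.*ₗ y)
  *ₗ-interchange a b x y = begin
    (a K.* b) R.*ₗ (x R.* y)     ≈⟨ L.*ₗ-assoc a b _ ⟩
    a R.*ₗ b R.*ₗ (x R.* y)      ≈⟨ L.*ₗ-congˡ (L.*ₗ-congˡ (R.*-comm x y)) ⟩
    a R.*ₗ b R.*ₗ (y R.* x)      ≈⟨ L.*ₗ-congˡ (R.*ₗ-*-assoc b y x) ⟨
    a R.*ₗ ((b R.*ₗ y) R.* x)    ≈⟨ L.*ₗ-congˡ (R.*-comm _ x) ⟩
    a R.*ₗ (x R.* (b R.*ₗ y))    ≈⟨ R.*ₗ-*-assoc a x _ ⟨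
    (a R.*ₗ x) R.* (b R.*ₗ y)    ∎

  ext-term* : ∀ a x u → ext (term* (a , x) u) R.≈ (a R.*ₗ g x) R.* ext u
  ext-term* a x []            = R.sym (R.zeroʳ _)
  ext-term* a x ((b , y) ∷ u) = begin
    ((a K.* b) R.*ₗ g (x M.∙ y)) R.+ ext (term* (a , x) u)
      ≈⟨ R.+-cong (L.*ₗ-congˡ (g-∙ x y)) (ext-term* a x u) ⟩
    ((a K.* b) R.*ₗ (g x R.* g y)) R.+ (a R.*ₗ g x) R.* ext u
      ≈⟨ R.+-congʳ (*ₗ-interchange a b (g x) (g y)) ⟩
    (a R.*ₗ g x) R.* (b R.*ₗ g y) R.+ (a R.*ₗ g x) R.* ext u
      ≈⟨ R.distribˡ _ _ _ ⟨
    (a R.*ₗ g x) R.* ((b R.*ₗ g y) R.+ ext u) ∎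

  ext-⊛ : ∀ u v → ext (u ⊛ v) R.≈ ext u R.* ext v
  ext-⊛ []            v = R.sym (R.zeroˡ _)
  ext-⊛ ((a , x) ∷ u) v = begin
    ext (term* (a , x) v ++ u ⊛ v)             ≈⟨ ext-++ g (term* (a , x) v) (u ⊛ v) ⟩
    ext (term* (a , x) v) R.+ ext (u ⊛ v)      ≈⟨ R.+-cong (ext-term* a x v) (ext-⊛ u v) ⟩
    (a R.*ₗ g x) R.* ext v R.+ ext u R.* ext v ≈⟨ R.distribʳ _ _ _ ⟨
    ((a R.*ₗ g x) R.+ ext u) R.* ext v         ∎

  algebraHomomorphism : AlgebraHomomorphism commutativeAlgebra R
  algebraHomomorphism = record
    { ⟦_⟧ = ext
    ; isAlgebraHomomorphism = record
      { isRingHomomorphism = record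
        { isSemiringHomomorphism = record
          { isNearSemiringHomomorphism = record
            { +-isMonoidHomomorphism = record
              { isMagmaHomomorphism = record
                { isRelHomomorphism = record { cong = ext-cong g g-cong }
                ; homo              = ext-++ g
                }
              ; ε-homo = R.refl
              }
            ; *-homo = ext-⊛
            }
          ; 1#-homo = R.trans (ext-basis g M.ε) g-ε
          }
        ; -‿homo = ext-negate g g-cong
        }
      ; *ₗ-homo = ext-scale g
      }
    }

-- Norms as morphisms out of the Grothendieck monoid.

module NormExtension {c ℓ u ℓu} {S : MinorsSystem c ℓ} {V : CommutativeMonoid u ℓu}
                     (𝒩 : Norm S V) where
  open MinorsSystem S
  open GrothendieckMonoid S
  open Norm 𝒩
  private module V = CommutativeMonoid V

  extend : Word → V.Carrier
  extend ⟨ X ⟩   = N X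
  extend ε       = V.ε
  extend (w · v) = extend w V.∙ extend v

  -- The relations specific to the Grothendieck monoid are exactly the norm axioms; the others are
  -- laws of commutative monoids.
  extend-cong : ∀ {w v} → w ∼ v → extend w V.≈ extend v
  extend-cong ∼-refl           = V.refl
  extend-cong (∼-sym p)        = V.sym (extend-cong p)
  extend-cong (∼-trans p q)    = V.trans (extend-cong p) (extend-cong q)
  extend-cong (·-cong p q)     = V.∙-cong (extend-cong p) (extend-cong q)
  extend-cong (·-assoc w v z)  = V.assoc _ _ _
  extend-cong (·-identity w)   = V.identityˡ _
  extend-cong (·-comm w v)     = V.comm _ _
  extend-cong (iso σ {X} p)    = V.trans (V.sym (N-invariant σ X)) (N-cong p)
  extend-cong (minors X A)     = N-minors X A
  extend-cong (sum X Y)        = N-⊕ X Y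
  extend-cong unit             = N-1

-- Isomorphism of structures and iterated minors.

module Isomorphism {c ℓ} (S : MinorsSystem c ℓ) where
  open MinorsSystem S
  private module Str {E : FinSet} = Setoid (obj E)

  infix 4 _≃_
  -- The minors laws hold along canonical bijections between different ground sets. Norms and `Φ`
  -- are invariant, so only the existence of a bijection has to be remembered, and the laws can be
  -- chained.
  record _≃_ {E F : FinSet} (X : S[ E ]) (Y : S[ F ]) : Set ℓ where
    constructor via
    field
      bijection : E ≅ F
      map-≈     : map {E} {F} bijection X ≈ Y

  open _≃_ public

  ≈⇒≃ : ∀ {E} {X Y : S[ E ]} → X ≈ Y → X ≃ Y
  ≈⇒≃ {E} {X} X≈Y = via (↔-id (Carrier E)) (Str.trans (map-id X) X≈Y)

  ≃-sym : ∀ {E F} {X : S[ E ]} {Y : S[ F ]} → X ≃ Y → Y ≃ X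
  ≃-sym {E} {F} {X} {Y} (via σ p) = via (↔-sym σ) (begin
    map {F} {E} (↔-sym σ) Y                    ≈⟨ map-cong {F} {E} (λ _ → refl) p ⟨
    map {F} {E} (↔-sym σ) (map {E} {F} σ X)    ≈⟨ map-∘ {E} {F} {E} (↔-sym σ) σ X ⟨
    map {E} {E} (↔-sym σ ↔-∘ σ) X              ≈⟨ map-cong {E} {E} (Inverse.strictlyInverseʳ σ)
                                                                 Str.refl ⟩
    map {E} {E} (↔-id (Carrier E)) X           ≈⟨ map-id X ⟩
    X                                          ∎)
    where open SetoidReasoning (obj E)

  ≃-trans : ∀ {E F G} {X : S[ E ]} {Y : S[ F ]} {Z : S[ G ]} → X ≃ Y → Y ≃ Z → X ≃ Z
  ≃-trans {E} {F} {G} {X} {Y} {Z} (via σ p) (via τ q) = via (τ ↔-∘ σ) (begin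
    map {E} {G} (τ ↔-∘ σ) X            ≈⟨ map-∘ {E} {F} {G} τ σ X ⟩
    map {F} {G} τ (map {E} {F} σ X)    ≈⟨ map-cong {F} {G} (λ _ → refl) p ⟩
    map {F} {G} τ Y                    ≈⟨ q ⟩
    Z                                  ∎)
    where open SetoidReasoning (obj G)

  map-≃ : ∀ {E F} (σ : E ≅ F) (X : S[ E ]) → X ≃ map {E} {F} σ X
  map-≃ σ X = via σ Str.refl

  ∣-≃ : ∀ {E F} {X : S[ E ]} {Y : S[ F ]} (p : X ≃ Y) (A : Sub E) (B : Sub F) →
        (A ∋ᵇ_) ≗ (B ∋ᵇ_) ∘ Inverse.to (bijection p) → X ∣ A ≃ Y ∣ B
  ∣-≃ {X = X} (via σ p) A B A≗B = via _ (Str.trans (map-∣ σ A B A≗B X) (∣-cong B p))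

  /-≃ : ∀ {E F} {X : S[ E ]} {Y : S[ F ]} (p : X ≃ Y) (A : Sub E) (B : Sub F) →
        (A ∋ᵇ_) ≗ (B ∋ᵇ_) ∘ Inverse.to (bijection p) → X / A ≃ Y / B
  /-≃ {X = X} (via σ p) A B A≗B = via _ (Str.trans (map-/ σ A B A≗B X) (/-cong B p))

  module _ {E : FinSet} (X : S[ E ]) (A B : Sub E) (A≗B : (A ∋ᵇ_) ≗ (B ∋ᵇ_)) where

    -- Minors by pointwise equal subsets live over different ground sets, so they are compared by
    -- transport along the identity of `E`.
    ∣-≗ : X ∣ A ≃ X ∣ B
    ∣-≗ = ∣-≃ (≈⇒≃ Str.refl) A B A≗B

    /-≗ : X / A ≃ X / B
    /-≗ = /-≃ (≈⇒≃ Str.refl) A B A≗B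

  module _ {E : FinSet} (X : S[ E ]) (A B : Sub E) (A≗B : (A ∋ᵇ_) ≗ (B ∋ᵇ_))
           (C : Sub ⟪ A ⟫) (D : Sub ⟪ B ⟫)
           (C≗D : (C ∋ᵇ_) ≗ (D ∋ᵇ_) ∘ Inverse.to (bijection (∣-≗ X A B A≗B))) where
    private
      X∣A≃X∣B : X ∣ A ≃ X ∣ B
      X∣A≃X∣B = ∣-≗ X A B A≗B

    ∣∣-≗ : (X ∣ A) ∣ C ≃ (X ∣ B) ∣ D
    ∣∣-≗ = ∣-≃ X∣A≃X∣B C D C≗D

    ∣/-≗ : (X ∣ A) / C ≃ (X ∣ B) / D
    ∣/-≗ = /-≃ X∣A≃X∣B C D C≗D

  module _ {E : FinSet} (X : S[ E ]) (C D A : Sub E) (disjoint : Disjoint C D)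
           (C∪D≗A : (C ∪ D ∋ᵇ_) ≗ (A ∋ᵇ_)) where

    -- B and B′ are C ∩ˢ A and D ∩ˢ ∁ C, characterised pointwise: with the sets themselves,
    -- conversion checking of the nested ground sets unfolds their enumerations and explodes.
    disjoint-∣ : (B : Sub ⟪ A ⟫) → (∀ x → (C ∋ᵇ proj₁ x) ≡ (B ∋ᵇ x)) → (X ∣ A) ∣ B ≃ X ∣ C
    disjoint-∣ B C≗B = ≃-trans (≃-sym spread) law
      where
      spread : (X ∣ (C ∪ D)) ∣ (C ∩ˢ (C ∪ D)) ≃ (X ∣ A) ∣ B
      spread = ∣∣-≗ X _ A C∪D≗A _ B (λ (e , e∈) → C≗B (e , _))

      law : (X ∣ (C ∪ D)) ∣ (C ∩ˢ (C ∪ D)) ≃ X ∣ C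
      law = via (Canonical.left≅ C D) (∣-∣ C D disjoint X)

    disjoint-/∣ : (B : Sub ⟪ A ⟫) → (∀ x → (C ∋ᵇ proj₁ x) ≡ (B ∋ᵇ x)) →
                  (B′ : Sub ⟪ ∁ C ⟫) → (∀ x → (D ∋ᵇ proj₁ x) ≡ (B′ ∋ᵇ x)) →
                  (X / C) ∣ B′ ≃ (X ∣ A) / B
    disjoint-/∣ B C≗B B′ D≗B′ = ≃-trans (≃-sym restrict) (≃-trans law spread)
      where
      restrict : (X / C) ∣ (D ∩ˢ ∁ C) ≃ (X / C) ∣ B′
      restrict = ∣-≗ (X / C) _ B′ D≗B′

      law : (X / C) ∣ (D ∩ˢ ∁ C) ≃ (X ∣ (C ∪ D)) / (C ∩ˢ (C ∪ D))
      law = ≃-trans (via (Canonical.right≅ C D disjoint) (/-∣ C D disjoint X))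
        (≃-sym (map-≃ (Canonical.∁left≅ C D disjoint) ((X ∣ (C ∪ D)) / (C ∩ˢ (C ∪ D)))))

      spread : (X ∣ (C ∪ D)) / (C ∩ˢ (C ∪ D)) ≃ (X ∣ A) / B
      spread = ∣/-≗ X _ A C∪D≗A _ B (λ (e , e∈) → C≗B (e , _))

    disjoint-/ : (B′ : Sub ⟪ ∁ C ⟫) → (∀ x → (D ∋ᵇ proj₁ x) ≡ (B′ ∋ᵇ x)) → (X / C) / B′ ≃ X / A
    disjoint-/ B′ D≗B′ = ≃-trans (≃-sym contract) (≃-trans law (/-≗ X (C ∪ D) A C∪D≗A))
      where
      contract : (X / C) / (D ∩ˢ ∁ C) ≃ (X / C) / B′
      contract = /-≗ (X / C) _ B′ D≗B′

      law : (X / C) / (D ∩ˢ ∁ C) ≃ X / (C ∪ D)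
      law = via (Canonical.∁∁≅ C D) (/-/ C D disjoint X)

  module _ {E : FinSet} (X : S[ E ]) (C A : Sub E) (C⊆A : C ⊆ A) where
    private
      -- The difference of `A` and `C`. It is disjoint from `C` with union `A`, which turns the laws
      -- for disjoint pairs into laws for nested pairs `C ⊆ A`.
      D : Sub E
      D = sub λ e → (A ∋ᵇ e) ∧ not (C ∋ᵇ e)

      disjoint : Disjoint C D
      disjoint e p q with C ∋ᵇ e | A ∋ᵇ e
      disjoint e p () | true | true
      disjoint e p () | true | false

      C∪D≗A : (C ∪ D ∋ᵇ_) ≗ (A ∋ᵇ_)
      C∪D≗A e with C ∋ᵇ e | A ∋ᵇ e | C⊆A e
      ... | true  | true  | _   = refl
      ... | true  | false | C⊆A = ⊥-elim (C⊆A tt)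
      ... | false | true  | _   = refl
      ... | false | false | _   = refl

      -- Outside `C` the difference and `A` agree, so the nested laws can characterise `B′` by `A`
      -- itself.
      D≗A : ∀ (x : Carrier ⟪ ∁ C ⟫) → (D ∋ᵇ proj₁ x) ≡ (A ∋ᵇ proj₁ x)
      D≗A (e , p) with C ∋ᵇ e | A ∋ᵇ e
      ... | false | true  = refl
      ... | false | false = refl

    nested-∣ : (B : Sub ⟪ A ⟫) → (∀ x → (C ∋ᵇ proj₁ x) ≡ (B ∋ᵇ x)) → (X ∣ A) ∣ B ≃ X ∣ C
    nested-∣ = disjoint-∣ X C D A disjoint C∪D≗A

    nested-/∣ : (B : Sub ⟪ A ⟫) → (∀ x → (C ∋ᵇ proj₁ x) ≡ (B ∋ᵇ x)) →
                (B′ : Sub ⟪ ∁ C ⟫) → (∀ x → (A ∋ᵇ proj₁ x) ≡ (B′ ∋ᵇ x)) →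
                (X / C) ∣ B′ ≃ (X ∣ A) / B
    nested-/∣ B C≗B B′ A≗B′ =
      disjoint-/∣ X C D A disjoint C∪D≗A B C≗B B′ (λ x → ≡.trans (D≗A x) (A≗B′ x))

    nested-/ : (B′ : Sub ⟪ ∁ C ⟫) → (∀ x → (A ∋ᵇ proj₁ x) ≡ (B′ ∋ᵇ x)) → (X / C) / B′ ≃ X / A
    nested-/ B′ A≗B′ =
      disjoint-/ X C D A disjoint C∪D≗A B′ (λ x → ≡.trans (D≗A x) (A≗B′ x))

  ∁full≅ : ∀ {E} → ⟪ ∁ (full {E}) ⟫ ≅ ∅
  ∁full≅ = mk↔ₛ′ (λ ()) (λ ()) (λ ()) (λ ())

  -- Applied to `X ∣ A`, this is `(X ∣ A) / A` expressed through the structure `X ∣ A` alone, which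
  -- makes invariance under `≃` immediate.
  contractAll : ∀ {E} → S[ E ] → S[ ∅ ]
  contractAll {E} X = map {⟪ ∁ (full {E}) ⟫} {∅} (∁full≅ {E}) (X / full)

  contractAll-≃ : ∀ {E F} {X : S[ E ]} {Y : S[ F ]} → X ≃ Y → contractAll X ≃ contractAll Y
  contractAll-≃ {E} {F} {X} {Y} p = ≃-trans (≃-sym (map-≃ (∁full≅ {E}) (X / full)))
    (≃-trans (/-≃ p full full (λ _ → refl)) (map-≃ (∁full≅ {F}) (Y / full)))

  -- Contracting `A` and then all that remains is the nested law for `A ⊆ full`.
  contractAll-/ : ∀ {E} (X : S[ E ]) (A : Sub E) → contractAll (X / A) ≃ contractAll X
  contractAll-/ {E} X A = ≃-trans (≃-sym (map-≃ (∁full≅ {⟪ ∁ A ⟫}) ((X / A) / full)))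
    (≃-trans (nested-/ X A full (λ _ _ → tt) full (λ _ → refl)) (map-≃ (∁full≅ {E}) (X / full)))

  self≃contractAll : ∀ {E} (X : S[ E ]) (A : Sub E) → X ∣ A /self ≃ contractAll (X ∣ A)
  self≃contractAll X A = ≃-trans (≃-sym (map-≃ (Canonical.∁self≅ A) ((X ∣ A) / (A ∩ˢ A))))
    (≃-trans all (map-≃ (∁full≅ {⟪ A ⟫}) ((X ∣ A) / full)))
    where
    all : (X ∣ A) / (A ∩ˢ A) ≃ (X ∣ A) / full
    -- Elements of the ground set of `X ∣ A` carry a proof of membership in `A`, so `A ∩ˢ A` is
    -- everything.
    all = /-≗ (X ∣ A) (A ∩ˢ A) full (λ (e , e∈A) → Equivalence.to T-≡ e∈A)

  -- Over a void ground set `full` and `empty` coincide, and contracting the empty set changes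
  -- nothing.
  contractAll-void : ∀ {E} → ¬ Carrier E → (X : S[ E ]) → contractAll X ≃ X
  contractAll-void {E} ¬e X = ≃-trans (≃-sym (map-≃ (∁full≅ {E}) (X / full)))
    (≃-trans none (via (Canonical.∁empty≅ {E}) (/-empty X)))
    where
    none : X / full ≃ X / empty
    none = /-≗ X full empty (⊥-elim ∘ ¬e)

  ∣-void : ∀ {E} → ¬ Carrier E → (X : S[ E ]) (A : Sub E) → X ∣ A ≃ X
  ∣-void {E} ¬e X A =
    ≃-trans (∣-≗ X A full (⊥-elim ∘ ¬e)) (via (Canonical.full≅ {E}) (∣-full X))

  module _ {u ℓu} {V : CommutativeMonoid u ℓu} (𝒩 : Norm S V) where
    open Norm 𝒩
    private module V = CommutativeMonoid V

    N-≃ : ∀ {E F} {X : S[ E ]} {Y : S[ F ]} → X ≃ Y → N X V.≈ N Y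
    N-≃ {X = X} (via σ p) = V.trans (V.sym (N-invariant σ X)) (N-cong p)

    N-∅ : (X : S[ ∅ ]) → N X V.≈ V.ε
    N-∅ X = V.trans (N-cong (Str.trans (Str.sym (⊕-identity X)) (⊕-comm X 1ₛ)))
                    (V.trans (N-⊕ 1ₛ X) N-1)

    N-void : ∀ {E} → ¬ Carrier E → (X : S[ E ]) → N X V.≈ V.ε
    N-void {E} ¬e X = V.trans (N-≃ (map-≃ {E} {∅} E≅∅ X)) (N-∅ (map {E} {∅} E≅∅ X))
      where
      E≅∅ : E ≅ ∅
      E≅∅ = mk↔ₛ′ (λ e → ⊥-elim (¬e e)) (λ ()) (λ ()) (λ e → ⊥-elim (¬e e))

    -- Multiplicativity applied to `X ∣ A` along `C`: restricting to `C` gives `X ∣ C`, and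
    -- contracting `C` commutes with restricting to `A`.
    N-nested-/ : ∀ {E} (X : S[ E ]) (C A : Sub E) → C ⊆ A →
                 (B′ : Sub ⟪ ∁ C ⟫) → (∀ x → (A ∋ᵇ proj₁ x) ≡ (B′ ∋ᵇ x)) →
                 N (X ∣ A) V.≈ N (X ∣ C) V.∙ N ((X / C) ∣ B′)
    -- Inside `split` the set `C ∩ˢ A` is a variable known only pointwise, so its enumeration stays
    -- folded.
    N-nested-/ X C A C⊆A B′ A≗B′ = split (C ∩ˢ A) (λ _ → refl)
      where
      split : (B : Sub ⟪ A ⟫) → (∀ x → (C ∋ᵇ proj₁ x) ≡ (B ∋ᵇ x)) →
              N (X ∣ A) V.≈ N (X ∣ C) V.∙ N ((X / C) ∣ B′)
      split B C≗B = V.trans (N-minors (X ∣ A) B)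
        (V.∙-cong (N-≃ (nested-∣ X C A C⊆A B C≗B))
                  (N-≃ (≃-sym (nested-/∣ X C A C⊆A B C≗B B′ A≗B′))))

    -- Multiplicativity applied to `X / C` along `A`: the restriction is `(X ∣ A) / C`, and the two
    -- contractions merge into `X / A`.
    N-nested-∣ : ∀ {E} (X : S[ E ]) (C A : Sub E) → C ⊆ A →
                 (B : Sub ⟪ A ⟫) → (∀ x → (C ∋ᵇ proj₁ x) ≡ (B ∋ᵇ x)) →
                 N (X / C) V.≈ N ((X ∣ A) / B) V.∙ N (X / A)
    N-nested-∣ X C A C⊆A B C≗B = split (A ∩ˢ ∁ C) (λ _ → refl)
      where
      split : (B′ : Sub ⟪ ∁ C ⟫) → (∀ x → (A ∋ᵇ proj₁ x) ≡ (B′ ∋ᵇ x)) →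
              N (X / C) V.≈ N ((X ∣ A) / B) V.∙ N (X / A)
      split B′ A≗B′ = V.trans (N-minors (X / C) B′)
        (V.∙-cong (N-≃ (nested-/∣ X C A C⊆A B C≗B B′ A≗B′))
                  (N-≃ (nested-/ X C A C⊆A B′ A≗B′)))

-- Finite sums in a semiring.

module ListSum {r ℓr} (R : CommutativeSemiring r ℓr) where
  private module R = CommutativeSemiring R

  sumOver : ∀ {a} {A : Set a} → (A → R.Carrier) → List A → R.Carrier
  sumOver g = List.foldr (λ x s → g x R.+ s) R.0#

  module _ {a} {A : Set a} where

    sumOver-cong : {g h : A → R.Carrier} → (∀ x → g x R.≈ h x) →
                   ∀ xs → sumOver g xs R.≈ sumOver h xs
    sumOver-cong g≈h []       = R.refl
    sumOver-cong g≈h (x ∷ xs) = R.+-cong (g≈h x) (sumOver-cong g≈h xs)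

    sumOver-++ : (g : A → R.Carrier) (xs ys : List A) →
                 sumOver g (xs ++ ys) R.≈ sumOver g xs R.+ sumOver g ys
    sumOver-++ g []       ys = R.sym (R.+-identityˡ _)
    sumOver-++ g (x ∷ xs) ys = R.trans (R.+-congˡ (sumOver-++ g xs ys)) (R.sym (R.+-assoc _ _ _))

    sumOver-map : ∀ {b} {B : Set b} (g : B → R.Carrier) (f : A → B) (xs : List A) →
                  sumOver g (List.map f xs) R.≈ sumOver (g ∘ f) xs
    sumOver-map g f []       = R.refl
    sumOver-map g f (x ∷ xs) = R.+-congˡ (sumOver-map g f xs)

    sumOver-*ˡ : (c : R.Carrier) (g : A → R.Carrier) (xs : List A) →
                 sumOver (λ x → c R.* g x) xs R.≈ c R.* sumOver g xs
    sumOver-*ˡ c g []       = R.sym (R.zeroʳ c)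
    sumOver-*ˡ c g (x ∷ xs) = R.trans (R.+-congˡ (sumOver-*ˡ c g xs)) (R.sym (R.distribˡ c _ _))

-- Singletons, complements and enumerated subsets.

∈⁅⁆⇒≡ : ∀ {E : FinSet} {e f : Carrier E} → f ∈ ⁅_⁆ {E} e → e ≡ f
∈⁅⁆⇒≡ {E} {e} {f} p with yes q ← Inverse.to (enum E) e Fin.≟ Inverse.to (enum E) f =
  -- Membership in a singleton is tested on indices; injectivity of the enumeration brings the
  -- equality back to `E`.
  Injection.injective (↔⇒↣ (enum E)) q

e∈⁅e⁆ : ∀ {E : FinSet} (e : Carrier E) → e ∈ ⁅_⁆ {E} e
e∈⁅e⁆ {E} e = subst T (≡.sym (dec-true (to e Fin.≟ to e) refl)) tt
  where open Inverse (enum E) using (to)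

∈∁⇒∉ : ∀ {E : FinSet} (A : Sub E) {e} → e ∈ ∁ A → ¬ (e ∈ A)
∈∁⇒∉ A {e} e∈∁A e∈A with A ∋ᵇ e
... | true  = e∈∁A
... | false = e∈A

∉⇒∈∁ : ∀ {E : FinSet} (A : Sub E) {e} → ¬ (e ∈ A) → e ∈ ∁ A
∉⇒∈∁ A {e} e∉A with A ∋ᵇ e
... | true  = e∉A tt
... | false = tt

module _ {E : FinSet} where

  subsetAlong : ∀ {n} → Carrier E ↔ Fin n → Subset n → Sub E
  subsetAlong σ s = sub λ e → lookup s (Inverse.to σ e)

  -- An enumeration of D = E ∖ first along which subsets of E restrict to D by forgetting
  -- their first bit.
  RestEnum : ∀ {n} → Carrier E ↔ Fin (suc n) → Sub E → Set
  RestEnum {n} σ D = Σ[ τ ∈ Carrier ⟪ D ⟫ ↔ Fin n ]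
    (∀ b s (x : Carrier ⟪ D ⟫) → (subsetAlong σ (b Vec.∷ s) ∋ᵇ proj₁ x) ≡ lookup s (Inverse.to τ x))

  -- The hypotheses say that `D` omits exactly the element of index `zero`, so punching out `zero`
  -- lowers every other index by one.
  restEnum : ∀ {n} (σ : Carrier E ↔ Fin (suc n)) (D : Sub E) →
             ¬ (Inverse.from σ zero ∈ D) → (∀ e → Inverse.from σ zero ≢ e → e ∈ D) → RestEnum σ D
  restEnum {n} σ D first∉D ≢first⇒∈D = τ , λ b s (e , e∈D) →
    -- `punchIn zero` is `suc`, and looking up a successor index skips the bit `b`.
    cong (lookup (b Vec.∷ s)) (≡.sym (Fin.punchIn-punchOut (0≢to e∈D)))
    where
    open Inverse σ

    0≢to : ∀ {e} → e ∈ D → zero ≢ to e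
    0≢to {e} e∈D 0≡ =
      first∉D (subst (_∈ D) (≡.sym (≡.trans (cong from 0≡) (strictlyInverseʳ e))) e∈D)

    from-suc∈D : ∀ i → from (suc i) ∈ D
    from-suc∈D i = ≢first⇒∈D _ λ p → Fin.0≢1+n
      (≡.trans (≡.sym (strictlyInverseˡ zero)) (≡.trans (cong to p) (strictlyInverseˡ (suc i))))

    τ : Carrier ⟪ D ⟫ ↔ Fin n
    τ = mk↔ₛ′
      (λ (e , e∈D) → punchOut (0≢to e∈D))
      (λ i → from (suc i) , from-suc∈D i)
      (λ i → Fin.suc-injective
        (≡.trans (Fin.punchIn-punchOut (0≢to (from-suc∈D i))) (strictlyInverseˡ (suc i))))
      (λ (e , e∈D) → member-≡ (D ∋ᵇ_)
        (≡.trans (cong from (Fin.punchIn-punchOut (0≢to e∈D))) (strictlyInverseʳ e)))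

  subsetAlong-first : ∀ {n} (σ : Carrier E ↔ Fin (suc n)) b s →
                      (subsetAlong σ (b Vec.∷ s) ∋ᵇ Inverse.from σ zero) ≡ b
  subsetAlong-first σ b s = cong (lookup (b Vec.∷ s)) (Inverse.strictlyInverseˡ σ zero)

-- Expansion over subsets from deletion-contraction.

module TutteExpansion {c ℓ r ℓr} (S : MinorsSystem c ℓ) (R : CommutativeSemiring r ℓr) where
  open MinorsSystem S
  open Isomorphism S
  open ListSum R
  private module R = CommutativeSemiring R
  open SetoidReasoning R.setoid
  open CommutativeSemigroupProperties R.*-commutativeSemigroup using (x∙yz≈y∙xz)

  module _ (f : ∀ {E} → S[ E ] → R.Carrier)
           (f-≃ : ∀ {E F} {X : S[ E ]} {Y : S[ F ]} → X ≃ Y → f X R.≈ f Y)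
           (𝒩₁ 𝒩₂ : Norm S R.*-commutativeMonoid) where
    open Norm 𝒩₁ using () renaming (N to N₁)
    open Norm 𝒩₂ using () renaming (N to N₂)

    -- By definition the value of `character`, introduced later, on the `A`-term of `tutteSum X`.
    weight : ∀ {E} → S[ E ] → Sub E → R.Carrier
    weight X A = N₁ (X ∣ A) R.* (f (X ∣ A /self) R.* N₂ (X / A))

    self-≃ : ∀ {E F} (X : S[ E ]) (A : Sub E) (Y : S[ F ]) (B : Sub F) →
             X ∣ A ≃ Y ∣ B → f (X ∣ A /self) R.≈ f (Y ∣ B /self)
    self-≃ X A Y B p = begin
      f (X ∣ A /self)              ≈⟨ f-≃ (self≃contractAll X A) ⟩
      f (contractAll (X ∣ A))      ≈⟨ f-≃ (contractAll-≃ p) ⟩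
      f (contractAll (Y ∣ B))      ≈⟨ f-≃ (self≃contractAll Y B) ⟨
      f (Y ∣ B /self)              ∎

    -- All of `A` gets contracted in the end, so contracting `D` first is harmless, and
    -- `(X ∣ A) / D` is `(X / D) ∣ A`.
    self-/ : ∀ {E} (X : S[ E ]) (D A : Sub E) → D ⊆ A →
             (B : Sub ⟪ ∁ D ⟫) → (∀ x → (A ∋ᵇ proj₁ x) ≡ (B ∋ᵇ x)) →
             f (X ∣ A /self) R.≈ f ((X / D) ∣ B /self)
    self-/ X D A D⊆A B A≗B = contract (D ∩ˢ A) (λ _ → refl)
      where
      contract : (C : Sub ⟪ A ⟫) → (∀ x → (D ∋ᵇ proj₁ x) ≡ (C ∋ᵇ x)) →
                 f (X ∣ A /self) R.≈ f ((X / D) ∣ B /self)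
      contract C D≗C = begin
        f (X ∣ A /self)                  ≈⟨ f-≃ (self≃contractAll X A) ⟩
        f (contractAll (X ∣ A))          ≈⟨ f-≃ (contractAll-/ (X ∣ A) C) ⟨
        f (contractAll ((X ∣ A) / C))    ≈⟨ f-≃ (contractAll-≃ (nested-/∣ X D A D⊆A C D≗C B A≗B)) ⟨
        f (contractAll ((X / D) ∣ B))    ≈⟨ f-≃ (self≃contractAll (X / D) B) ⟨
        f ((X / D) ∣ B /self)            ∎

    -- Only the first factor changes: `N₁` of `X ∣ A` splits along `D`. The other two see the same
    -- minors of `X / D` as of `X`.
    weight-/ : ∀ {E} (X : S[ E ]) (D A : Sub E) → D ⊆ A →
               (B : Sub ⟪ ∁ D ⟫) → (∀ x → (A ∋ᵇ proj₁ x) ≡ (B ∋ᵇ x)) →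
               weight X A R.≈ N₁ (X ∣ D) R.* weight (X / D) B
    weight-/ X D A D⊆A B A≗B = begin
      N₁ (X ∣ A) R.* (f (X ∣ A /self) R.* N₂ (X / A))
        ≈⟨ R.*-cong (N-nested-/ 𝒩₁ X D A D⊆A B A≗B)
             (R.*-cong (self-/ X D A D⊆A B A≗B) (N-≃ 𝒩₂ (≃-sym (nested-/ X D A D⊆A B A≗B)))) ⟩
      (N₁ (X ∣ D) R.* N₁ ((X / D) ∣ B)) R.* (f ((X / D) ∣ B /self) R.* N₂ ((X / D) / B))
        ≈⟨ R.*-assoc _ _ _ ⟩
      N₁ (X ∣ D) R.* weight (X / D) B ∎

    -- Dual to `weight-/`: restricting to `D` leaves `X ∣ A` alone, and it is `N₂` of `X / A` that
    -- splits, along `D`.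
    weight-∣ : ∀ {E} (X : S[ E ]) (D A : Sub E) → A ⊆ D →
               (B : Sub ⟪ D ⟫) → (∀ x → (A ∋ᵇ proj₁ x) ≡ (B ∋ᵇ x)) →
               weight X A R.≈ N₂ (X / D) R.* weight (X ∣ D) B
    weight-∣ X D A A⊆D B A≗B = begin
      N₁ (X ∣ A) R.* (f (X ∣ A /self) R.* N₂ (X / A))
        ≈⟨ R.*-cong (N-≃ 𝒩₁ X∣A≃) (R.*-cong (self-≃ X A (X ∣ D) B X∣A≃)
             (R.trans (N-nested-∣ 𝒩₂ X A D A⊆D B A≗B) (R.*-comm _ _))) ⟩
      N₁ ((X ∣ D) ∣ B) R.* (f ((X ∣ D) ∣ B /self) R.* (N₂ (X / D) R.* N₂ ((X ∣ D) / B)))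
        ≈⟨ R.*-congˡ (x∙yz≈y∙xz _ _ _) ⟩
      N₁ ((X ∣ D) ∣ B) R.* (N₂ (X / D) R.* (f ((X ∣ D) ∣ B /self) R.* N₂ ((X ∣ D) / B)))
        ≈⟨ x∙yz≈y∙xz _ _ _ ⟩
      N₂ (X / D) R.* weight (X ∣ D) B ∎
      where
      X∣A≃ : X ∣ A ≃ (X ∣ D) ∣ B
      X∣A≃ = ≃-sym (nested-∣ X A D A⊆D B A≗B)

    weight-void : ∀ {E} → ¬ Carrier E → (X : S[ E ]) (A : Sub E) → weight X A R.≈ f X
    weight-void ¬e X A = begin
      N₁ (X ∣ A) R.* (f (X ∣ A /self) R.* N₂ (X / A))
        ≈⟨ R.*-cong (N-void 𝒩₁ (¬e ∘ proj₁) (X ∣ A)) (R.*-congˡ (N-void 𝒩₂ (¬e ∘ proj₁) (X / A))) ⟩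
      R.1# R.* (f (X ∣ A /self) R.* R.1#)
        ≈⟨ R.trans (R.*-identityˡ _) (R.*-identityʳ _) ⟩
      f (X ∣ A /self)
        ≈⟨ f-≃ (self≃contractAll X A) ⟩
      f (contractAll (X ∣ A))
        ≈⟨ f-≃ (contractAll-void (¬e ∘ proj₁) (X ∣ A)) ⟩
      f (X ∣ A)
        ≈⟨ f-≃ (∣-void ¬e X A) ⟩
      f X ∎

    -- In the application D is ⁅ e ⁆ and D′ is ∁ ⁅ e ⁆, while A, B and C enumerate the subsets of
    -- E, of ∁ D and of D′; they are variables for the same reason as in disjoint-∣.
    module _ {n} {E : FinSet} (X : S[ E ]) (D D′ : Sub E) (D≗∁D′ : (D ∋ᵇ_) ≗ (∁ D′ ∋ᵇ_))
             (A : Subset (suc n) → Sub E) (B : Subset n → Sub ⟪ ∁ D ⟫) (C : Subset n → Sub ⟪ D′ ⟫)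
             where
      expansion-step :
        (∀ s → D ⊆ A (inside Vec.∷ s)) →
        (∀ s → A (outside Vec.∷ s) ⊆ D′) →
        (∀ s x → (A (inside Vec.∷ s) ∋ᵇ proj₁ x) ≡ (B s ∋ᵇ x)) →
        (∀ s x → (A (outside Vec.∷ s) ∋ᵇ proj₁ x) ≡ (C s ∋ᵇ x)) →
        f X R.≈ N₁ (X ∖ D′) R.* f (X / D) R.+ N₂ (X / D′) R.* f (X ∣ D′) →
        f (X / D) R.≈ sumOver (weight (X / D) ∘ B) (subsetsFin n) →
        f (X ∣ D′) R.≈ sumOver (weight (X ∣ D′) ∘ C) (subsetsFin n) →
        f X R.≈ sumOver (weight X ∘ A) (subsetsFin (suc n))
      expansion-step D⊆A A⊆D′ A≗B A≗C dc expand-/ expand-∣ = begin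
        f X
          ≈⟨ dc ⟩
        a R.* f (X / D) R.+ b R.* f (X ∣ D′)
          ≈⟨ R.+-cong (R.*-congˡ expand-/) (R.*-congˡ expand-∣) ⟩
        a R.* sumOver w/ L R.+ b R.* sumOver w∣ L
          ≈⟨ R.+-cong (sumOver-*ˡ a w/ L) (sumOver-*ˡ b w∣ L) ⟨
        sumOver (λ s → a R.* w/ s) L R.+ sumOver (λ s → b R.* w∣ s) L
          ≈⟨ R.+-cong (sumOver-cong weight-inside L) (sumOver-cong weight-outside L) ⟨
        sumOver (w ∘ (inside Vec.∷_)) L R.+ sumOver (w ∘ (outside Vec.∷_)) L
          -- `subsetsFin` lists the subsets avoiding the first element before those containing it,
          -- while the contraction term comes first in the relation.
          ≈⟨ R.+-comm _ _ ⟩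
        sumOver (w ∘ (outside Vec.∷_)) L R.+ sumOver (w ∘ (inside Vec.∷_)) L
          ≈⟨ R.+-cong (sumOver-map w (outside Vec.∷_) L) (sumOver-map w (inside Vec.∷_) L) ⟨
        sumOver w (List.map (outside Vec.∷_) L) R.+ sumOver w (List.map (inside Vec.∷_) L)
          ≈⟨ sumOver-++ w (List.map (outside Vec.∷_) L) _ ⟨
        sumOver w (subsetsFin (suc n)) ∎
        where
        a b : R.Carrier
        a = N₁ (X ∖ D′)
        b = N₂ (X / D′)

        L : List (Subset n)
        L = subsetsFin n

        w : Subset (suc n) → R.Carrier
        w = weight X ∘ A

        w/ w∣ : Subset n → R.Carrier
        w/ = weight (X / D) ∘ B
        w∣ = weight (X ∣ D′) ∘ C

        X∣D≃X∖D′ : X ∣ D ≃ X ∖ D′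
        X∣D≃X∖D′ = ∣-≗ X D (∁ D′) D≗∁D′

        weight-inside : ∀ s → w (inside Vec.∷ s) R.≈ a R.* w/ s
        weight-inside s = R.trans (weight-/ X D (A (inside Vec.∷ s)) (D⊆A s) (B s) (A≗B s))
                                  (R.*-congʳ (N-≃ 𝒩₁ X∣D≃X∖D′))

        weight-outside : ∀ s → w (outside Vec.∷ s) R.≈ b R.* w∣ s
        weight-outside s = weight-∣ X D′ (A (outside Vec.∷ s)) (A⊆D′ s) (C s) (A≗C s)

    module _ {n} {E : FinSet} (X : S[ E ]) (σ : Carrier E ↔ Fin (suc n)) (D D′ : Sub E)
             (D≗∁D′ : (D ∋ᵇ_) ≗ (∁ D′ ∋ᵇ_)) (first∈D : Inverse.from σ zero ∈ D)
             (∈D⇒first : ∀ {f} → f ∈ D → Inverse.from σ zero ≡ f) where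
      private
        ∈D⇒∉D′ : ∀ {f} → f ∈ D → ¬ (f ∈ D′)
        ∈D⇒∉D′ {f} f∈D = ∈∁⇒∉ D′ (subst T (D≗∁D′ f) f∈D)

        ∉D⇒∈D′ : ∀ {f} → ¬ (f ∈ D) → f ∈ D′
        ∉D⇒∈D′ {f} f∉D = subst T (not-involutive (D′ ∋ᵇ f))
          (∉⇒∈∁ {E} (∁ D′) (f∉D ∘ subst T (≡.sym (D≗∁D′ f))))

        D⊆inside : ∀ s → D ⊆ subsetAlong σ (inside Vec.∷ s)
        D⊆inside s f f∈D = subst (_∈ subsetAlong {E} σ (inside Vec.∷ s)) (∈D⇒first f∈D)
          (Equivalence.from T-≡ (subsetAlong-first {E} σ inside s))

        outside⊆D′ : ∀ s → subsetAlong σ (outside Vec.∷ s) ⊆ D′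
        outside⊆D′ s f f∈A = ∉D⇒∈D′ λ f∈D → subst T
          (≡.trans (cong (subsetAlong {E} σ (outside Vec.∷ s) ∋ᵇ_) (≡.sym (∈D⇒first f∈D)))
                   (subsetAlong-first {E} σ outside s))
          f∈A

        enum-/ : RestEnum {E} σ (∁ D)
        enum-/ = restEnum {E} σ (∁ D) (λ p → ∈∁⇒∉ D p first∈D)
          (λ f e≢f → ∉⇒∈∁ D (e≢f ∘ ∈D⇒first))

        enum-∣ : RestEnum {E} σ D′
        enum-∣ = restEnum {E} σ D′ (∈D⇒∉D′ first∈D)
          (λ f e≢f → ∉D⇒∈D′ (e≢f ∘ ∈D⇒first))

      -- The relation is used at the element of index `zero`: then `D` is its singleton, `D′` the
      -- complement, and the first bit of a subset decides whether it contains `D` or lies in `D′`.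
      -- Both minors are enumerated by `n` indices.
      expansion-at-first :
        (∀ {F} (τ : Carrier F ↔ Fin n) (Y : S[ F ]) →
           f Y R.≈ sumOver (weight Y ∘ subsetAlong τ) (subsetsFin n)) →
        f X R.≈ N₁ (X ∖ D′) R.* f (X / D) R.+ N₂ (X / D′) R.* f (X ∣ D′) →
        f X R.≈ sumOver (weight X ∘ subsetAlong σ) (subsetsFin (suc n))
      expansion-at-first expansion dc = go enum-/ enum-∣
        where
        go : RestEnum {E} σ (∁ D) → RestEnum {E} σ D′ →
             f X R.≈ sumOver (weight X ∘ subsetAlong σ) (subsetsFin (suc n))
        go (τ/ , A≗τ/) (τ∣ , A≗τ∣) =
          expansion-step X D D′ D≗∁D′ (subsetAlong σ) (subsetAlong τ/) (subsetAlong τ∣)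
            D⊆inside outside⊆D′ (A≗τ/ inside) (A≗τ∣ outside) dc
            (expansion τ/ (X / D)) (expansion τ∣ (X ∣ D′))

    module _ (deletion-contraction : ∀ {E} (X : S[ E ]) (e : Carrier E) →
                f X R.≈ N₁ (X ∖ ∁ (⁅_⁆ {E} e)) R.* f (X / ⁅_⁆ {E} e)
                          R.+ N₂ (X / ∁ (⁅_⁆ {E} e)) R.* f (X ∖ ⁅_⁆ {E} e)) where

      -- Induction on the number of elements. The enumeration is arbitrary because the minors are
      -- enumerated through `restEnum`, not by the enumeration stored in their ground sets.
      tutte-expansion : ∀ n {E} (σ : Carrier E ↔ Fin n) (X : S[ E ]) →
                        f X R.≈ sumOver (weight X ∘ subsetAlong σ) (subsetsFin n)
      tutte-expansion zero    {E} σ X =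
        R.sym (R.trans (R.+-identityʳ _)
          (weight-void {E} (Fin.¬Fin0 ∘ Inverse.to σ) X (subsetAlong σ Vec.[])))
      tutte-expansion (suc n) {E} σ X =
        go (⁅_⁆ {E} e) (∁ {E} (⁅_⁆ {E} e)) refl refl
        where
        e : Carrier E
        e = Inverse.from σ zero

        -- `D` and `D′` remain variables; their equations are matched only in the small facts below,
        -- which keeps the types of the minors folded.
        go : (D D′ : Sub E) → D ≡ ⁅_⁆ {E} e → D′ ≡ ∁ D →
             f X R.≈ sumOver (weight X ∘ subsetAlong σ) (subsetsFin (suc n))
        go D D′ D≡⁅e⁆ D′≡∁D =
          expansion-at-first X σ D D′ (D≗∁D′ D′≡∁D) (e∈D D≡⁅e⁆) (∈D⇒e D≡⁅e⁆)
            (tutte-expansion n) (dc D≡⁅e⁆ D′≡∁D)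
          where
          D≗∁D′ : D′ ≡ ∁ D → (D ∋ᵇ_) ≗ (∁ D′ ∋ᵇ_)
          D≗∁D′ refl x = ≡.sym (not-involutive (D ∋ᵇ x))

          e∈D : D ≡ ⁅_⁆ {E} e → e ∈ D
          e∈D refl = e∈⁅e⁆ {E} e

          ∈D⇒e : D ≡ ⁅_⁆ {E} e → ∀ {x} → x ∈ D → e ≡ x
          ∈D⇒e refl = ∈⁅⁆⇒≡ {E}

          dc : D ≡ ⁅_⁆ {E} e → D′ ≡ ∁ D →
               f X R.≈ N₁ (X ∖ D′) R.* f (X / D) R.+ N₂ (X / D′) R.* f (X ∣ D′)
          dc refl refl = deletion-contraction X e

-- Factorisation through the universal Tutte character.

module Factorisation {k ℓk c ℓ r ℓr} (K : CommutativeRing k ℓk) (S : MinorsSystem c ℓ)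
                     (R : CommutativeAlgebra K r ℓr) where
  open MinorsSystem S
  open LinearSpecies K species
  open UniversalTutteCharacter K S
  open GrothendieckMonoid S using (⟨_⟩)
  open Isomorphism S using (_≃_; via)
  private
    module K = CommutativeRing K
    module R = CommutativeAlgebra R
    module KU = CommutativeAlgebra K[U×S∅×U]
    module M = CommutativeMonoid U×S∅×U
    module R-mod = LeftModule R.leftModule
  open ListSum R.commutativeSemiring
  open TutteExpansion S R.commutativeSemiring
  open SetoidReasoning R.setoid
  open CommutativeSemigroupProperties R.*-commutativeSemigroup using (interchange)
  open LinearExtension K M.setoid R.leftModule using (ext-++; ext-scale; ext-basis)

  linearNorm-structure : (𝒩 : Norm S R.*-commutativeMonoid) → ∀ {E} (X : S[ E ]) →
                         linearNorm R 𝒩 (structure X) R.≈ Norm.N 𝒩 X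
  linearNorm-structure 𝒩 {E} X = LinearExtension.ext-basis K (obj E) R.leftModule (Norm.N 𝒩) X

  -- `tutteSum X` is the case of the list `subsets E`; an arbitrary list permits induction.
  basisSum : ∀ {a} {A : Set a} → (A → M.Carrier) → List A → KU.Carrier
  basisSum t xs = List.foldr KU._+_ KU.0# (List.map (FreeModule.basis K M.setoid ∘ t) xs)

  module _ (Φ : Morphism R.leftModule)
           (φ∅-hom : IsAlgebraHomomorphism (MonoidAlgebra.commutativeAlgebra K S∅-commutativeMonoid)
                       R (Morphism.⟦_⟧ Φ {∅}))
           (𝒩₁ 𝒩₂ : Norm S R.*-commutativeMonoid)
           (deletion-contraction : ∀ {E : FinSet} (X : S[ E ]) (e : Carrier E) →
              Morphism.⟦_⟧ Φ (structure X) R.≈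
                linearNorm R 𝒩₁ (structure (X ∖ ∁ (⁅_⁆ {E} e)))
                    R.* Morphism.⟦_⟧ Φ (structure (X / ⁅_⁆ {E} e))
                  R.+ linearNorm R 𝒩₂ (structure (X / ∁ (⁅_⁆ {E} e)))
                    R.* Morphism.⟦_⟧ Φ (structure (X ∖ ⁅_⁆ {E} e))) where
    open Morphism Φ using (isLinear; invariant) renaming (⟦_⟧ to φ)
    private
      module E₁ = NormExtension 𝒩₁
      module E₂ = NormExtension 𝒩₂
      module φ∅ = Morphisms.RingMorphisms.IsRingHomomorphism
        (IsAlgebraHomomorphism.isRingHomomorphism φ∅-hom)
      module Linear {E : FinSet} =
        ModuleMorphism.LeftModuleMorphisms.IsLeftModuleHomomorphism (isLinear {E})

    f : ∀ {E} → S[ E ] → R.Carrier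
    f X = φ (structure X)

    f-cong : ∀ {E} {X Y : S[ E ]} → X ≈ Y → f X R.≈ f Y
    f-cong {E} X≈Y = Linear.⟦⟧-cong (FreeModule.∷-cong K.refl X≈Y FreeModule.≋-refl)

    f-≃ : ∀ {E F} {X : S[ E ]} {Y : S[ F ]} → X ≃ Y → f X R.≈ f Y
    f-≃ {X = X} (via σ p) = R.trans (R.sym (invariant σ (structure X))) (f-cong p)

    character : M.Carrier → R.Carrier
    character (u , Y , v) = E₁.extend u R.* (f Y R.* E₂.extend v)

    f-⊕ : ∀ (Y Z : S[ ∅ ]) → f (Y ⊕ Z) R.≈ f Y R.* f Z
    f-⊕ Y Z = R.trans
      -- A product of two basis elements has coefficient `1# * 1#`.
      (φ∅.⟦⟧-cong (FreeModule.∷-cong (K.sym (K.*-identityˡ K.1#)) (Setoid.refl (obj ∅))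
        FreeModule.≋-refl))
      (φ∅.*-homo (structure Y) (structure Z))

    -- Each of the three factors is multiplicative: the outer two because `extend` is so by
    -- construction, the middle one because `Φ` is an algebra morphism on the empty ground set. The
    -- interchange law regroups the product.
    character-homomorphism :
      Morphisms.MonoidMorphisms.IsMonoidHomomorphism M.rawMonoid R.*-rawMonoid character
    character-homomorphism = record
      { isMagmaHomomorphism = record
        { isRelHomomorphism = record
          { cong = λ (p , q , s) →
              R.*-cong (E₁.extend-cong p) (R.*-cong (f-cong q) (E₂.extend-cong s)) }
        ; homo = λ (u , Y , v) (u′ , Y′ , v′) → R.trans
            (R.*-congˡ (R.trans (R.*-congʳ (f-⊕ Y Y′)) (interchange _ _ _ _)))
            (interchange _ _ _ _)
        }
      ; ε-homo = R.trans (R.*-identityˡ _) (R.trans (R.*-identityʳ _) φ∅.1#-homo)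
      }

    open MonoidAlgebraExtension K U×S∅×U R character-homomorphism public
      using (ext; algebraHomomorphism)

    ext-basisSum : ∀ {a} {A : Set a} (t : A → M.Carrier) (xs : List A) →
                   ext (basisSum t xs) R.≈ sumOver (character ∘ t) xs
    ext-basisSum t []       = R.refl
    ext-basisSum t (x ∷ xs) =
      R.trans (ext-++ character (FreeModule.basis K M.setoid (t x)) (basisSum t xs))
              (R.+-cong (ext-basis character (t x)) (ext-basisSum t xs))

    f-tutteSum : ∀ {E} (X : S[ E ]) → f X R.≈ ext (tutteSum {E} X)
    f-tutteSum {E} X = begin
      f X
        ≈⟨ tutte-expansion f f-≃ 𝒩₁ 𝒩₂ dc (FinSet.card E) (enum E) X ⟩
      sumOver (weight f f-≃ 𝒩₁ 𝒩₂ X ∘ subsetAlong (enum E)) (subsetsFin (FinSet.card E))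
        -- `subsets E` is the list of bit vectors read along the stored enumeration of `E`.
        ≈⟨ sumOver-map (weight f f-≃ 𝒩₁ 𝒩₂ X) (subsetAlong (enum E)) (subsetsFin (FinSet.card E)) ⟨
      sumOver (weight f f-≃ 𝒩₁ 𝒩₂ X) (subsets E)
        ≈⟨ ext-basisSum term (subsets E) ⟨
      ext (tutteSum {E} X) ∎
      where
      dc : ∀ {E} (X : S[ E ]) (e : Carrier E) →
           f X R.≈ Norm.N 𝒩₁ (X ∖ ∁ (⁅_⁆ {E} e)) R.* f (X / ⁅_⁆ {E} e)
                     R.+ Norm.N 𝒩₂ (X / ∁ (⁅_⁆ {E} e)) R.* f (X ∖ ⁅_⁆ {E} e)
      dc X e = R.trans (deletion-contraction X e)
        (R.+-cong (R.*-congʳ (linearNorm-structure 𝒩₁ _)) (R.*-congʳ (linearNorm-structure 𝒩₂ _)))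

      term : Sub E → M.Carrier
      term A = ⟨_⟩ {⟪ A ⟫} (X ∣ A) , X ∣ A /self , ⟨_⟩ {⟪ ∁ A ⟫} (X / A)

    -- Both sides are linear, so agreement on single structures, which is `f-tutteSum`, suffices.
    φ≈ext∘T^S : ∀ {E} (x : ∣KS[ E ]∣) → φ x R.≈ ext (T^S x)
    φ≈ext∘T^S {E} x =
      R.trans (LinearExtension.homomorphism≈ext K (obj E) R.leftModule (isLinear {E}) x) (go x)
      where
      go : ∀ x → FreeModule.linearExtension K (obj E) R.leftModule f x R.≈ ext (T^S x)
      go []            = R.refl
      go ((a , X) ∷ x) = begin
        (a R.*ₗ f X) R.+ FreeModule.linearExtension K (obj E) R.leftModule f x
          ≈⟨ R.+-cong (R-mod.*ₗ-congˡ (f-tutteSum X)) (go x) ⟩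
        (a R.*ₗ ext (tutteSum X)) R.+ ext (T^S x)
          ≈⟨ R.+-congʳ (ext-scale character a (tutteSum X)) ⟨
        ext (a KU.*ₗ tutteSum X) R.+ ext (T^S x)
          ≈⟨ ext-++ character (a KU.*ₗ tutteSum X) (T^S x) ⟨
        ext (T^S ((a , X) ∷ x)) ∎

proposition3p20 :
  ∀ {k ℓk c ℓ r ℓr}
  (K : CommutativeRing k ℓk) (S : MinorsSystem c ℓ) (R : CommutativeAlgebra K r ℓr) →
  let open MinorsSystem S
      open LinearSpecies K species
      open UniversalTutteCharacter K S
      module R = CommutativeAlgebra R
  in
  (Φ : Morphism R.leftModule) →
  let open Morphism Φ using () renaming (⟦_⟧ to φ) in
  IsAlgebraHomomorphism (MonoidAlgebra.commutativeAlgebra K S∅-commutativeMonoid) R (φ {∅}) →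
  (N₁ N₂ : Norm S R.*-commutativeMonoid) →
  (∀ {E : FinSet} (X : S[ E ]) (e : FinSet.Carrier E) →
     φ (structure X) R.≈
       linearNorm R N₁ (structure (X ∖ ∁ ⁅ e ⁆)) R.* φ (structure (X / ⁅ e ⁆))
         R.+ linearNorm R N₂ (structure (X / ∁ ⁅ e ⁆)) R.* φ (structure (X ∖ ⁅ e ⁆))) →
  Σ[ Φ̄ ∈ AlgebraHomomorphism K[U×S∅×U] R ]
    (∀ {E : FinSet} (x : ∣KS[ E ]∣) → φ x R.≈ AlgebraHomomorphism.⟦_⟧ Φ̄ (T^S x))
proposition3p20 K S R Φ φ∅-hom N₁ N₂ deletion-contraction =
  algebraHomomorphism Φ φ∅-hom N₁ N₂ deletion-contraction ,
  φ≈ext∘T^S Φ φ∅-hom N₁ N₂ deletion-contraction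
  where open Factorisation K S R
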